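{- For every $n,\lambda\in\mathbb{N}$ and each $\mu\in\{0,\dots,\lambda\}$, we have $$OP_{\Gamma_n,\operatorname{Rot}(\Gamma_n)}(\lambda,\mu)=\frac1n\sum_{d\mid n}\varphi\!\left(\frac nd\right)V_d(\lambda-1,\mu-\lambda)\,-\,\mu+1$$ if $n$ is odd, and $$OP_{\Gamma_n,\operatorname{Rot}(\Gamma_n)}(\lambda,\mu)=\frac1n\sum_{d\mid n}\varphi\!\left(\frac nd\right)V_d(\lambda-1,\mu-\lambda)$$ if $n$ is even.
   Context: $\mathbb{N}$ denotes the positive integers. For $n\ge1$, $\Gamma_n$ is the cycle of length $n$, with vertex set $\{0,\dots,n-1\}$ and edges $\{v,(v+1)\bmod n\}$ for $v=0,\dots,n-1$; thus $\Gamma_1$ is a single vertex with a loop, and $\Gamma_2$ consists of two vertices joined by two parallel edges. $\operatorname{Rot}(\Gamma_n)=\{r_0,\dots,r_{n-1}\}$ is the group of rotations, where $r_m(v)=(v+m)\bmod n$. A $\lambda$-coloring of a graph $\Gamma$ is a map $f$ from its vertex set to $\{1,\dots,\lambda\}$; it is $\mu$-proper if for every pair of adjacent vertices $v,w$, either $f(v)\ne f(w)$ or $f(v)=f(w)>\mu$ (a vertex with a loop is adjacent to itself, so it must get a color $>\mu$). For a subgroup $G$ of the automorphism group of $\Gamma$ (viewed as permutations of the vertices), $OP_{\Gamma,G}(\lambda,\mu)$ is the number of equivalence classes of $\mu$-proper $\lambda$-colorings of $\Gamma$, where $f$ and $f'$ are equivalent if $f'=f\circ g$ for some $g\in G$.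 $\varphi$ is Euler's totient function, and the sums run over the positive divisors $d$ of $n$. For integers $P,Q$, the Lucas sequence of the second kind is defined by $V_0(P,Q)=2$, $V_1(P,Q)=P$, and $V_n(P,Q)=P\,V_{n-1}(P,Q)-Q\,V_{n-2}(P,Q)$ for $n>1$. -}

module Defs where

open import Data.Fin.Base using (Fin; zero; suc; toℕ; finToFun; funToFin)
open import Data.Fin.Permutation as Perm
  using (Permutation′; permutation; _⟨$⟩ʳ_; _∘ₚ_; inverseʳ)
open import Data.Fin.Properties as Fin
  using (toℕ-injective; toℕ-fromℕ<; toℕ<n; toℕ≤n; finToFun-funToFin)
open import Data.Integer.Base as ℤ using (ℤ; +_)
open import Data.List.Base
  using (List; []; _∷_; map; foldr; length; lookup; filter; upTo; allFin; deduplicate)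
open import Data.List.Membership.Propositional using () renaming (_∈_ to _∈≡_)
open import Data.List.Membership.Propositional.Properties using (∈-map⁺; ∈-allFin; ∈-lookup)
open import Data.List.Relation.Unary.AllPairs using (_∷_)
open import Data.List.Relation.Unary.Any using (here; there)
import Data.List.Relation.Unary.All as All
import Data.List.Relation.Unary.Enumerates.Setoid as Enumerates
open import Data.List.Relation.Unary.Enumerates.Setoid.Properties
  using (deduplicate⁺; lookup-surjective)
import Data.List.Relation.Unary.Unique.Setoid as Unique
open import Data.List.Relation.Unary.Unique.DecSetoid.Properties using (deduplicate-!)
open import Data.Nat.Base as ℕ using (ℕ; zero; suc; NonZero; _+_; _∸_; _<_; _%_)
open import Data.Nat.Coprimality using (coprime?)
open import Data.Nat.Divisibility using (_∣?_)
open import Data.Nat.DivMod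
  using (_mod_; m%n<n; %-distribˡ-+; m%n%n≡m%n; [m+n]%n≡m%n; m<n⇒m%n≡m)
open import Data.Nat.Properties
  using (+-comm; +-assoc; _<?_; m+[n∸m]≡n; m∸n+n≡m)
open import Data.Product.Base using (_×_; _,_; proj₁; proj₂; ∃)
open import Data.Product.Properties using (≡-dec)
open import Data.Sum.Base using (_⊎_; inj₁; inj₂)
open import Function.Base using (_∘_)
open import Function.Bundles using (Bijection)
open import Level using (0ℓ)
open import Relation.Binary.Bundles using (Setoid; DecSetoid)
open import Relation.Binary.PropositionalEquality as ≡
  using (_≡_; _≢_; _≗_; refl; sym; trans; cong; subst)
open import Relation.Nullary using (Dec; yes; no; ¬?; contradiction)
open import Relation.Nullary.Decidable using (_⊎-dec_; _×-dec_; _→-dec_)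

-- Finite multigraphs, with loops and parallel edges allowed.  The orientation
-- implicit in the pair `ends e` is irrelevant: see `Joins`.

record Graph : Set where
  field
    order : ℕ
    size  : ℕ
    ends  : Fin size → Fin order × Fin order

  Vertex Edge : Set
  Vertex = Fin order
  Edge   = Fin size

  Joins : Edge → Vertex → Vertex → Set
  Joins e v w = ends e ≡ (v , w) ⊎ ends e ≡ (w , v)

  Adjacent : Vertex → Vertex → Set
  Adjacent v w = ∃ λ e → Joins e v w

  adjacent? : ∀ v w → Dec (Adjacent v w)
  adjacent? v w = Fin.any? λ e → (ends e ≟ (v , w)) ⊎-dec (ends e ≟ (w , v))
    where _≟_ = ≡-dec Fin._≟_ Fin._≟_

  -- A vertex permutation that is induced by an automorphism of the multigraph.
  IsAutomorphism : Permutation′ order → Set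
  IsAutomorphism σ = ∃ λ (τ : Permutation′ size) →
    ∀ e v w → Joins e v w → Joins (τ ⟨$⟩ʳ e) (σ ⟨$⟩ʳ v) (σ ⟨$⟩ʳ w)

-- Subgroups of the automorphism group, presented by a finite family listing
-- their elements (repetitions are harmless).

record AutSubgroup (Γ : Graph) : Set where
  open Graph Γ
  field
    card         : ℕ
    element      : Fin card → Permutation′ order
    automorphism : ∀ i → IsAutomorphism (element i)
    id-closed    : ∃ λ i → element i Perm.≈ Perm.id
    ∘-closed     : ∀ i j → ∃ λ k → element k Perm.≈ (element i ∘ₚ element j)
    ⁻¹-closed    : ∀ i → ∃ λ j → element j Perm.≈ Perm.flip (element i)

-- The colors {1,…,ℓ} are represented by Fin ℓ.

color : ∀ {ℓ} → Fin ℓ → ℕ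
color c = suc (toℕ c)

module _ (Γ : Graph) (ℓ μ : ℕ) where
  open Graph Γ

  IsProper : (Vertex → Fin ℓ) → Set
  IsProper f = ∀ v w → Adjacent v w → f v ≢ f w ⊎ (f v ≡ f w × μ < color (f v))

  isProper? : ∀ f → Dec (IsProper f)
  isProper? f = Fin.all? λ v → Fin.all? λ w → adjacent? v w →-dec
    (¬? (f v Fin.≟ f w) ⊎-dec ((f v Fin.≟ f w) ×-dec (μ <? color (f v))))

  record ProperColoring : Set where
    constructor mkProper
    field
      coloring : Vertex → Fin ℓ
      proper   : IsProper coloring

open ProperColoring public

module _ (Γ : Graph) (G : AutSubgroup Γ) (ℓ μ : ℕ) where
  open Graph Γ
  open AutSubgroup G

  Equivalent : ProperColoring Γ ℓ μ → ProperColoring Γ ℓ μ → Set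
  Equivalent f f′ = ∃ λ i → coloring f′ ≗ coloring f ∘ (element i ⟨$⟩ʳ_)

  coloringClasses : DecSetoid 0ℓ 0ℓ
  coloringClasses = record
    { Carrier          = ProperColoring Γ ℓ μ
    ; _≈_              = Equivalent
    ; isDecEquivalence = record
      { isEquivalence = record
        { refl  = λ {f} → proj₁ id-closed , λ v → cong (coloring f) (sym (proj₂ id-closed v))
        ; sym   = λ {f} {f′} (i , f′≗) → let (j , j≈) = ⁻¹-closed i in j , λ v →
            sym (trans (f′≗ _) (cong (coloring f)
              (trans (cong (element i ⟨$⟩ʳ_) (j≈ v)) (inverseʳ (element i)))))
        ; trans = λ {f} {f′} {f″} (i , f′≗) (j , f″≗) → let (k , k≈) = ∘-closed j i in k , λ v →
            trans (f″≗ v) (trans (f′≗ _) (cong (coloring f) (sym (k≈ v))))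
        }
      ; _≟_ = λ f f′ → Fin.any? λ i → Fin.all? λ v → coloring f′ v Fin.≟ coloring f (element i ⟨$⟩ʳ v)
      }
    }

module _ (S : DecSetoid 0ℓ 0ℓ) where
  open DecSetoid S using (setoid; _≈_; _≟_) renaming (sym to ≈-sym; reflexive to ≈-reflexive)
  open Unique setoid using (Unique)
  open Enumerates setoid using (IsEnumeration)

  lookup-injective : ∀ {xs} → Unique xs → ∀ {i j} → lookup xs i ≈ lookup xs j → i ≡ j
  lookup-injective {_ ∷ xs} (x∉ ∷ u) {zero}  {zero}  _  = refl
  lookup-injective {_ ∷ xs} (x∉ ∷ u) {zero}  {suc j} eq =
    contradiction eq (All.lookup x∉ (∈-lookup {xs = xs} j))
  lookup-injective {_ ∷ xs} (x∉ ∷ u) {suc i} {zero}  eq =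
    contradiction (≈-sym eq) (All.lookup x∉ (∈-lookup {xs = xs} i))
  lookup-injective {_ ∷ xs} (x∉ ∷ u) {suc i} {suc j} eq = cong suc (lookup-injective u eq)

  finite : ∀ xs → IsEnumeration xs → ∃ λ k → Bijection (≡.setoid (Fin k)) setoid
  finite xs enum = length ys , record
    { to        = lookup ys
    ; cong      = ≈-reflexive ∘ cong (lookup ys)
    ; bijective = lookup-injective (deduplicate-! S xs)
                , lookup-surjective setoid (deduplicate⁺ S enum)
    }
    where ys = deduplicate _≟_ xs

module _ (Γ : Graph) (G : AutSubgroup Γ) (ℓ μ : ℕ) where
  open Graph Γ
  open DecSetoid (coloringClasses Γ G ℓ μ) using (setoid) renaming (refl to ≈-refl)
  open AutSubgroup G
  open import Data.List.Membership.Setoid setoid using (_∈_)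

  properOnes : List (Vertex → Fin ℓ) → List (ProperColoring Γ ℓ μ)
  properOnes []       = []
  properOnes (f ∷ fs) with isProper? Γ ℓ μ f
  ... | yes p = mkProper f p ∷ properOnes fs
  ... | no  _ = properOnes fs

  ∈-properOnes : ∀ {fs} (f : ProperColoring Γ ℓ μ) {g : Vertex → Fin ℓ} →
                 g ≗ coloring f → g ∈≡ fs → f ∈ properOnes fs
  ∈-properOnes {g ∷ fs} f g≗f (here refl) with isProper? Γ ℓ μ g
  ... | yes p = here (proj₁ id-closed , λ v →
                  trans (g≗f v) (cong (coloring f) (sym (proj₂ id-closed v))))
  ... | no ¬p = contradiction g-proper ¬p
    where
    g-proper : IsProper Γ ℓ μ g
    g-proper v w adj with proper f v w adj
    ... | inj₁ ≢         = inj₁ λ eq → ≢ (trans (sym (g≗f v)) (trans eq (g≗f w)))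
    ... | inj₂ (eq , lt) = inj₂ ( trans (g≗f v) (trans eq (sym (g≗f w)))
                                , subst (λ c → μ < color c) (sym (g≗f v)) lt)
  ∈-properOnes {g ∷ fs} f g≗f (there g∈) with isProper? Γ ℓ μ g
  ... | yes _ = there (∈-properOnes f g≗f g∈)
  ... | no  _ = ∈-properOnes f g≗f g∈

  coloringClasses-finite : ∃ λ k → Bijection (≡.setoid (Fin k)) setoid
  coloringClasses-finite = finite (coloringClasses Γ G ℓ μ)
    (properOnes (map finToFun (allFin (ℓ ℕ.^ order))))
    λ f → ∈-properOnes f (finToFun-funToFin (coloring f))
                         (∈-map⁺ finToFun (∈-allFin (funToFin (coloring f))))

  OP : ℕ
  OP = proj₁ coloringClasses-finite

module _ (n : ℕ) .{{_ : NonZero n}} where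

  rotate : ℕ → Fin n → Fin n
  rotate m v = (toℕ v + m) mod n

  toℕ-rotate : ∀ m v → toℕ (rotate m v) ≡ (toℕ v + m) % n
  toℕ-rotate m v = toℕ-fromℕ< (m%n<n (toℕ v + m) n)

  %-+ˡ : ∀ a b → (a % n + b) % n ≡ (a + b) % n
  %-+ˡ a b = trans (%-distribˡ-+ (a % n) b n)
    (trans (cong (λ x → (x + b % n) % n) (m%n%n≡m%n a n)) (sym (%-distribˡ-+ a b n)))

  rotate-+ : ∀ a b v → rotate b (rotate a v) ≡ rotate (a + b) v
  rotate-+ a b v = toℕ-injective (trans (toℕ-rotate b _)
    (trans (cong (λ x → (x + b) % n) (toℕ-rotate a v))
    (trans (%-+ˡ (toℕ v + a) b)
    (trans (cong (_% n) (+-assoc (toℕ v) a b)) (sym (toℕ-rotate (a + b) v))))))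

  rotate-% : ∀ a v → rotate (a % n) v ≡ rotate a v
  rotate-% a v = toℕ-injective (trans (toℕ-rotate (a % n) v)
    (trans (cong (_% n) (+-comm (toℕ v) (a % n)))
    (trans (%-+ˡ a (toℕ v))
    (trans (cong (_% n) (+-comm a (toℕ v))) (sym (toℕ-rotate a v))))))

  rotate-n : ∀ v → rotate n v ≡ v
  rotate-n v = toℕ-injective (trans (toℕ-rotate n v)
    (trans ([m+n]%n≡m%n (toℕ v) n) (m<n⇒m%n≡m (toℕ<n v))))

  rotate-mod : ∀ a v → rotate (toℕ (a mod n)) v ≡ rotate a v
  rotate-mod a v = trans (cong (λ x → rotate x v) (toℕ-fromℕ< (m%n<n a n))) (rotate-% a v)

  rotate-rotate⁻¹ : ∀ (m : Fin n) v → rotate (toℕ m) (rotate (n ∸ toℕ m) v) ≡ v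
  rotate-rotate⁻¹ m v = trans (rotate-+ _ (toℕ m) v)
    (trans (cong (λ x → rotate x v) (m∸n+n≡m (toℕ≤n m))) (rotate-n v))

  rotate⁻¹-rotate : ∀ (m : Fin n) v → rotate (n ∸ toℕ m) (rotate (toℕ m) v) ≡ v
  rotate⁻¹-rotate m v = trans (rotate-+ (toℕ m) _ v)
    (trans (cong (λ x → rotate x v) (m+[n∸m]≡n (toℕ≤n m))) (rotate-n v))

  rotate-comm : ∀ a b v → rotate a (rotate b v) ≡ rotate b (rotate a v)
  rotate-comm a b v = trans (rotate-+ b a v)
    (trans (cong (λ x → rotate x v) (+-comm b a)) (sym (rotate-+ a b v)))

  r : Fin n → Permutation′ n
  r m = permutation (rotate (toℕ m)) (rotate (n ∸ toℕ m)) (rotate-rotate⁻¹ m) (rotate⁻¹-rotate m)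

  cycle : Graph
  cycle = record
    { order = n
    ; size  = n
    ; ends  = λ v → v , (toℕ v + 1) mod n
    }

  Rot : AutSubgroup cycle
  Rot = record
    { card         = n
    ; element      = r
    ; automorphism = λ m → r m , λ where
        e _ _ (inj₁ refl) → inj₁ (cong (rotate (toℕ m) e ,_) (rotate-comm 1 (toℕ m) e))
        e _ _ (inj₂ refl) → inj₂ (cong (rotate (toℕ m) e ,_) (rotate-comm 1 (toℕ m) e))
    ; id-closed    = n mod n , λ v → trans (rotate-mod n v) (rotate-n v)
    ; ∘-closed     = λ a b → (toℕ a + toℕ b) mod n , λ v →
        trans (rotate-mod (toℕ a + toℕ b) v) (sym (rotate-+ (toℕ a) (toℕ b) v))
    ; ⁻¹-closed    = λ a → (n ∸ toℕ a) mod n , rotate-mod (n ∸ toℕ a)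
    }

φ : ℕ → ℕ
φ n = length (filter (λ k → coprime? k n) (map suc (upTo n)))

-- The index i runs over {0,…,n-1} and stands for the divisor d = suc i.
∑-divisors : (n : ℕ) → ((d : ℕ) .{{_ : NonZero d}} → ℤ) → ℤ
∑-divisors n F = foldr ℤ._+_ (+ 0) (map (λ i → F (suc i)) (filter (λ i → suc i ∣? n) (upTo n)))

lucasV : ℤ → ℤ → ℕ → ℤ
lucasV P Q zero          = + 2
lucasV P Q (suc zero)    = P
lucasV P Q (suc (suc n)) = P ℤ.* lucasV P Q (suc n) ℤ.- Q ℤ.* lucasV P Q n

{-# OPTIONS --safe #-}

-- By Burnside's lemma n · OP is the sum over m of the number of proper colorings of Γₙ
-- fixed by rₘ, and these are the proper colorings of Γ_d repeated n/d times, d = gcd(m,n).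
-- Proper colorings of Γ_d are closed walks of length d for the transfer matrix A = J − D,
-- where J is all ones and D projects onto the colors ≤ μ.  Besides −1 and 0, A has the two
-- roots of x² − (ℓ−1)x − (ℓ−μ) as eigenvalues, and tr A^d = V_d(ℓ−1, μ−ℓ) + (μ−1)(−1)^d.
-- Summing V over gcd(m,n) gives the divisor sum, and Σₘ (−1)^gcd(m,n) is −n or 0 according
-- to the parity of n.
module Submission where

open import Defs
open import Data.Bool.Base using (true; false; if_then_else_)
open import Data.Fin.Base
  using (Fin; zero; suc; toℕ; fromℕ; fromℕ<; inject₁; finToFun; funToFin; combine; _↑ˡ_; _↑ʳ_)
open import Data.Fin.Permutation using (_⟨$⟩ʳ_)
import Data.Fin.Properties as Fin
open import Data.Fin.Relation.Unary.Top using (view; ‵fromℕ; ‵inject₁)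
open import Data.Integer.Base as ℤ using (ℤ; +_; 0ℤ; 1ℤ)
import Data.Integer.Properties as ℤ
open import Data.Integer.Tactic.RingSolver using (solve-∀)
open import Data.List.Base using (foldr; filter; map; length; applyUpTo)
open import Data.Nat.Base as ℕ using (ℕ; zero; suc; NonZero; _≤_; _<_; _%_; s≤s)
open import Data.Nat.Coprimality using (Coprime; coprime?; coprime⇒gcd≡1; gcd≡1⇒coprime)
open import Data.Nat.Divisibility
  using (_∣_; _∤_; _∣?_; divides; ∣⇒≤; ∣-refl; ∣-trans; ∣-antisym; %-presˡ-∣; ∣n∣m%n⇒∣m; ∣m∣n⇒∣m+n; ∣m+n∣m⇒∣n)
open import Data.Nat.DivMod
  using (_mod_; m%n<n; n%n≡0; m<n⇒m%n≡m; m*n/n≡m; m∣n⇒o%n%m≡o%m; m≡m%n+[m/n]*n; %-remove-+ʳ)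
open import Data.Nat.GCD
  using (GCD; gcd; gcd-GCD; gcd[m,n]∣m; gcd[m,n]∣n; gcd[m,n]≤n; gcd[m,n]≢0; gcd-greatest; c*gcd[m,n]≡gcd[cm,cn]; module Bézout)
import Data.Nat.Properties as ℕ
open import Data.Product.Base using (_×_; _,_; proj₁; proj₂; ∃)
open import Data.Rational.Base using (_/_; _+_; _-_; _*_; 1ℚ; toℚᵘ; -_)
import Data.Rational.Properties as ℚ
open import Data.Rational.Unnormalised.Base as ℚᵘ using (mkℚᵘ; *≡*)
import Data.Rational.Unnormalised.Properties as ℚᵘ
open import Data.Sum.Base using (_⊎_; inj₁; inj₂)
open import Data.Unit.Base using (tt)
open import Function.Base using (_∘_; id)
open import Function.Bundles using (_⇔_; mk⇔; Equivalence; Bijection)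
open import Relation.Binary.Bundles using (DecSetoid)
open import Relation.Binary.PropositionalEquality
  using (_≡_; _≢_; _≗_; refl; sym; trans; cong; cong₂; subst; subst₂; module ≡-Reasoning)
open import Relation.Nullary using (Dec; yes; no; ¬_; ¬?; does; contradiction)
open import Relation.Nullary.Decidable using (does-⇔; _×-dec_; _⊎-dec_)
open import Relation.Unary using (Decidable)
open import Algebra.Properties.Semiring.Sum ℤ.+-*-semiring
  using (sum; sum-syntax; sum-cong-≗; sum-replicate-zero; ∑-distrib-+; ∑-comm; ∑-permute; *-distribˡ-sum; *-distribʳ-sum)

open ≡-Reasoning

-- The eigenvalues of A never appear. Their multiplicities, μ - 1 for -1 and ℓ - μ - 1 for 0, would
-- be negative at μ = 0 and at μ = ℓ, so a diagonalisation would split into cases. Instead one takes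
-- the trace of A^(k+1) = J A^k - D A^k: tr (J A^k) is the sum of all entries of A^k, which obeys a
-- two-term recurrence, and D² = D gives a one-step recursion for tr (D A^k). This works uniformly
-- for μ ≤ ℓ. Colorings are functions, and without extensionality only their pointwise equality is
-- usable. Hence every count is an integer sum of indicators over codes `x` in `Fin (ℓ ^ n)`, and
-- counts are compared through a relation that is one-to-one on both sides. Burnside's lemma becomes
-- such a double count, in which no orbit or stabilizer size is ever divided.

private
  variable
    m n ℓ : ℕ
    A B : Set

-- Counting by sums of indicators.

-- Iverson bracket, with values in ℤ because counts are later subtracted. It looks only at `does`,
-- so equivalent propositions give equal brackets whatever their decision procedures.
⟦_⟧ : Dec A → ℤ
⟦ a? ⟧ = if does a? then 1ℤ else 0ℤ

⟦⟧-cong : A ⇔ B → (a? : Dec A) (b? : Dec B) → ⟦ a? ⟧ ≡ ⟦ b? ⟧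
⟦⟧-cong A⇔B a? b? = cong (if_then 1ℤ else 0ℤ) (does-⇔ A⇔B a? b?)

⟦⟧-yes : (a? : Dec A) → A → ⟦ a? ⟧ ≡ 1ℤ
⟦⟧-yes (yes _) a = refl
⟦⟧-yes (no ¬a) a = contradiction a ¬a

⟦⟧-no : (a? : Dec A) → ¬ A → ⟦ a? ⟧ ≡ 0ℤ
⟦⟧-no (yes a) ¬a = contradiction a ¬a
⟦⟧-no (no _)  ¬a = refl

⟦⟧-× : (a? : Dec A) (b? : Dec B) → ⟦ a? ×-dec b? ⟧ ≡ ⟦ a? ⟧ ℤ.* ⟦ b? ⟧
⟦⟧-× (yes _) b? = sym (ℤ.*-identityˡ ⟦ b? ⟧)
⟦⟧-× (no _)  b? = refl

∑-zero : (f : Fin n → ℤ) → (∀ i → f i ≡ 0ℤ) → sum f ≡ 0ℤ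
∑-zero {n} f f≡0 = trans (sum-cong-≗ f≡0) (sum-replicate-zero n)

∑-single : (f : Fin n → ℤ) (i : Fin n) → (∀ j → j ≢ i → f j ≡ 0ℤ) → sum f ≡ f i
∑-single f zero    f≡0 = trans (cong (ℤ._+_ (f zero)) (∑-zero (f ∘ suc) λ j → f≡0 (suc j) λ ()))
                               (ℤ.+-identityʳ (f zero))
∑-single f (suc i) f≡0 = trans (cong₂ ℤ._+_ (f≡0 zero λ ()) (∑-single (f ∘ suc) i λ j j≢i →
                                 f≡0 (suc j) (j≢i ∘ Fin.suc-injective)))
                               (ℤ.+-identityˡ (f (suc i)))

∑-const : ∀ n x → (∑[ i < n ] x) ≡ + n ℤ.* x
∑-const zero    x = refl
∑-const (suc n) x = trans (cong (ℤ._+_ x) (∑-const n x)) (sym (ℤ.suc-* (+ n) x))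

-- If A fails, no index satisfies E; if A holds, exactly one does. This is the inner sum of a double
-- count.
∑-fibre : {E : Fin n → Set} (a? : Dec A) (E? : ∀ i → Dec (E i)) →
          (∀ {i} → E i → A) → (A → ∃ E) → (∀ {i j} → E i → E j → i ≡ j) →
          (∑[ i < n ] ⟦ E? i ⟧) ≡ ⟦ a? ⟧
∑-fibre (no ¬a) E? E⇒A _ _ = ∑-zero _ λ i → ⟦⟧-no (E? i) (¬a ∘ E⇒A)
∑-fibre (yes a) E? _ A⇒E unique with A⇒E a
... | i , e = trans (∑-single _ i λ j j≢i → ⟦⟧-no (E? j) λ e′ → j≢i (unique e′ e))
                    (⟦⟧-yes (E? i) e)

-- The pairs in E are counted in two ways.
∑-bijection : {P : Fin m → Set} {Q : Fin n → Set} {E : Fin m → Fin n → Set}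
              (P? : ∀ i → Dec (P i)) (Q? : ∀ j → Dec (Q j)) (E? : ∀ i j → Dec (E i j)) →
              (∀ {i j} → E i j → P i) → (∀ {i} → P i → ∃ λ j → E i j) →
              (∀ {i j j′} → E i j → E i j′ → j ≡ j′) →
              (∀ {i j} → E i j → Q j) → (∀ {j} → Q j → ∃ λ i → E i j) →
              (∀ {i i′ j} → E i j → E i′ j → i ≡ i′) →
              (∑[ i < m ] ⟦ P? i ⟧) ≡ (∑[ j < n ] ⟦ Q? j ⟧)
∑-bijection {m} {n} P? Q? E? E⇒P P⇒E uniqueʳ E⇒Q Q⇒E uniqueˡ = begin
  ∑[ i < m ] ⟦ P? i ⟧              ≡⟨ sum-cong-≗ (λ i → sym (∑-fibre (P? i) (E? i) E⇒P P⇒E uniqueʳ)) ⟩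
  ∑[ i < m ] ∑[ j < n ] ⟦ E? i j ⟧ ≡⟨ ∑-comm (λ i j → ⟦ E? i j ⟧) ⟩
  ∑[ j < n ] ∑[ i < m ] ⟦ E? i j ⟧ ≡⟨ sum-cong-≗ (λ j → ∑-fibre (Q? j) (λ i → E? i j) E⇒Q Q⇒E uniqueˡ) ⟩
  ∑[ j < n ] ⟦ Q? j ⟧              ∎

∑-minus : (f g : Fin n → ℤ) → (∑[ i < n ] (f i ℤ.- g i)) ≡ sum f ℤ.- sum g
∑-minus {zero}  f g = refl
∑-minus {suc n} f g = trans (cong (ℤ._+_ (f zero ℤ.- g zero)) (∑-minus (f ∘ suc) (g ∘ suc)))
                            (lemma (f zero) (g zero) (sum (f ∘ suc)) (sum (g ∘ suc)))
  where
  lemma : ∀ a b c d → (a ℤ.- b) ℤ.+ (c ℤ.- d) ≡ (a ℤ.+ c) ℤ.- (b ℤ.+ d)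
  lemma = solve-∀

∑-+ : ∀ m {n} (f : Fin (m ℕ.+ n) → ℤ) → sum f ≡ sum (λ i → f (i ↑ˡ n)) ℤ.+ sum (λ j → f (m ↑ʳ j))
∑-+ zero    f = sym (ℤ.+-identityˡ (sum f))
∑-+ (suc m) f = trans (cong (ℤ._+_ (f zero)) (∑-+ m (f ∘ suc))) (sym (ℤ.+-assoc (f zero) _ _))

∑-combine : ∀ m {n} (f : Fin (m ℕ.* n) → ℤ) → sum f ≡ (∑[ i < m ] ∑[ j < n ] f (combine i j))
∑-combine zero    f = refl
∑-combine (suc m) {n} f = trans (∑-+ n f) (cong (ℤ._+_ (∑[ j < n ] f (combine {suc m} zero j))) (∑-combine m (λ k → f (n ↑ʳ k))))

infix 4 _≗?_
_≗?_ : (f g : Fin n → Fin ℓ) → Dec (f ≗ g)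
f ≗? g = Fin.all? λ v → f v Fin.≟ g v

-- Lets pointwise equality of decoded functions identify their codes, which replaces function
-- extensionality in all uniqueness arguments.
finToFun-injective : ∀ {m n} {x y : Fin (m ℕ.^ n)} → finToFun {m} {n} x ≗ finToFun y → x ≡ y
finToFun-injective {m} {n} {x} {y} eq = begin
  x                             ≡⟨ Fin.funToFin-finToFin {n} {m} x ⟨
  funToFin (finToFun {m} {n} x) ≡⟨ funToFin-cong eq ⟩
  funToFin (finToFun {m} {n} y) ≡⟨ Fin.funToFin-finToFin {n} {m} y ⟩
  y                             ∎
  where
  funToFin-cong : ∀ {n} {f g : Fin n → Fin m} → f ≗ g → funToFin f ≡ funToFin g
  funToFin-cong {zero}  f≗g = refl
  funToFin-cong {suc n} f≗g = cong₂ combine (f≗g zero) (funToFin-cong (f≗g ∘ suc))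

-- Burnside's lemma for the rotations.

module _ (n ℓ μ : ℕ) .{{_ : NonZero n}} where

  proper? : (f : Fin n → Fin ℓ) → Dec (IsProper (cycle n) ℓ μ f)
  proper? = isProper? (cycle n) ℓ μ

  fixed? : (m : ℕ) (f : Fin n → Fin ℓ) → Dec (IsProper (cycle n) ℓ μ f × f ∘ rotate n m ≗ f)
  fixed? m f = proper? f ×-dec (f ∘ rotate n m ≗? f)

  private
    module Classes = DecSetoid (coloringClasses (cycle n) (Rot n) ℓ μ)

  module _ {k : ℕ} (ρ : Fin k → ProperColoring (cycle n) ℓ μ)
           (ρ-injective : ∀ {i j} → ρ i Classes.≈ ρ j → i ≡ j)
           (ρ-surjective : ∀ f → ∃ λ i → ρ i Classes.≈ f) where

    private
      rotated : Fin k → Fin n → Fin n → Fin ℓ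
      rotated i m = coloring (ρ i) ∘ rotate n (toℕ m)

    rotated-proper : ∀ i m → IsProper (cycle n) ℓ μ (rotated i m)
    rotated-proper i m v w (e , joins) =
      proper (ρ i) _ _ (AutSubgroup.automorphism (Rot n) m .proj₁ ⟨$⟩ʳ e
                       , AutSubgroup.automorphism (Rot n) m .proj₂ e v w joins)

    proper-resp-≗ : ∀ {f g} → f ≗ g → IsProper (cycle n) ℓ μ f → IsProper (cycle n) ℓ μ g
    proper-resp-≗ f≗g p v w adj rewrite sym (f≗g v) | sym (f≗g w) = p v w adj

    -- For proper f = ρᵢ ∘ r_a, the m with f ∘ r_m = f are those with ρᵢ ∘ r_{m+a} = f.
    stabilizer-count : ∀ f → (∑[ m < n ] ⟦ fixed? (toℕ m) f ⟧) ≡ (∑[ i < k ] ∑[ m < n ] ⟦ rotated i m ≗? f ⟧)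
    stabilizer-count f with proper? f
    ... | no ¬p = trans (∑-zero {n} _ λ m → ⟦⟧-no (fixed? (toℕ m) f) (¬p ∘ proj₁)) (sym (∑-zero _ λ i → ∑-zero _ λ m →
                    ⟦⟧-no (rotated i m ≗? f) λ eq → ¬p (proper-resp-≗ eq (rotated-proper i m))))
    ... | yes p with ρ-surjective (mkProper f p)
    ...   | i , a , f≗ = sym (begin
      ∑[ i < k ] ∑[ m < n ] ⟦ rotated i m ≗? f ⟧
        ≡⟨ ∑-single _ i (λ j j≢i → ∑-zero _ λ m → ⟦⟧-no (rotated j m ≗? f) λ eq →
             j≢i (ρ-injective (Classes.trans {i = ρ j} {mkProper f p} {ρ i}
                    (m , sym ∘ eq) (Classes.sym {x = ρ i} {mkProper f p} (a , f≗))))) ⟩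
      ∑[ m < n ] ⟦ rotated i m ≗? f ⟧
        ≡⟨ ∑-permute (λ m → ⟦ rotated i m ≗? f ⟧) (r n a) ⟩
      ∑[ m < n ] ⟦ rotated i (rotate n (toℕ a) m) ≗? f ⟧
        ≡⟨ sum-cong-≗ (λ m → ⟦⟧-cong (mk⇔ (λ eq → p , λ v → trans (shift m v) (eq v))
                                          (λ (_ , eq) v → trans (sym (shift m v)) (eq v)))
             (rotated i (rotate n (toℕ a) m) ≗? f) (fixed? (toℕ m) f)) ⟩
      ∑[ m < n ] ⟦ fixed? (toℕ m) f ⟧ ∎)
      where
      shift : ∀ m v → f (rotate n (toℕ m) v) ≡ rotated i (rotate n (toℕ a) m) v
      shift m v = begin
        f (rotate n (toℕ m) v)                             ≡⟨ f≗ _ ⟩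
        coloring (ρ i) (rotate n (toℕ a) (rotate n (toℕ m) v))
          ≡⟨ cong (coloring (ρ i)) (rotate-+ n (toℕ m) (toℕ a) v) ⟩
        coloring (ρ i) (rotate n (toℕ m ℕ.+ toℕ a) v)
          ≡⟨ cong (coloring (ρ i)) (rotate-mod n (toℕ m ℕ.+ toℕ a) v) ⟨
        rotated i (rotate n (toℕ a) m) v                   ∎

    -- By `stabilizer-count` the pairs of a rotation and a coloring fixed by it are as many as the
    -- triples `(i , m , f)` with `rotated i m` equal to `f`. Such a triple is determined by `i` and
    -- `m`. Of `ρ` only one thing is used: it meets every class exactly once.
    burnside′ : (∑[ m < n ] ∑[ x < ℓ ℕ.^ n ] ⟦ fixed? (toℕ m) (finToFun x) ⟧) ≡ + n ℤ.* + k
    burnside′ = begin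
      ∑[ m < n ] ∑[ x < ℓ ℕ.^ n ] ⟦ fixed? (toℕ m) (finToFun x) ⟧
        ≡⟨ ∑-comm {n} {ℓ ℕ.^ n} (λ m x → ⟦ fixed? (toℕ m) (finToFun x) ⟧) ⟩
      ∑[ x < ℓ ℕ.^ n ] ∑[ m < n ] ⟦ fixed? (toℕ m) (finToFun x) ⟧
        ≡⟨ sum-cong-≗ {ℓ ℕ.^ n} (λ x → stabilizer-count (finToFun x)) ⟩
      ∑[ x < ℓ ℕ.^ n ] ∑[ i < k ] ∑[ m < n ] ⟦ rotated i m ≗? finToFun x ⟧
        ≡⟨ ∑-comm {ℓ ℕ.^ n} {k} (λ x i → ∑[ m < n ] ⟦ rotated i m ≗? finToFun x ⟧) ⟩
      ∑[ i < k ] ∑[ x < ℓ ℕ.^ n ] ∑[ m < n ] ⟦ rotated i m ≗? finToFun x ⟧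
        ≡⟨ sum-cong-≗ (λ i → ∑-comm {ℓ ℕ.^ n} {n} (λ x m → ⟦ rotated i m ≗? finToFun x ⟧)) ⟩
      ∑[ i < k ] ∑[ m < n ] ∑[ x < ℓ ℕ.^ n ] ⟦ rotated i m ≗? finToFun x ⟧
        -- With the true proposition, `∑-fibre` says that exactly one code represents `rotated i m`.
        ≡⟨ sum-cong-≗ (λ i → sum-cong-≗ (λ m → ∑-fibre {n = ℓ ℕ.^ n} (yes tt) (λ x → rotated i m ≗? finToFun x)
             (λ _ → tt) (λ _ → funToFin (rotated i m) , λ v → sym (Fin.finToFun-funToFin (rotated i m) v))
             (λ p q → finToFun-injective {ℓ} {n} (λ v → trans (sym (p v)) (q v))))) ⟩
      ∑[ i < k ] ∑[ m < n ] 1ℤ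
        ≡⟨ ∑-const k _ ⟩
      + k ℤ.* (∑[ m < n ] 1ℤ)
        ≡⟨ cong (+ k ℤ.*_) (trans (∑-const n 1ℤ) (ℤ.*-identityʳ (+ n))) ⟩
      + k ℤ.* + n
        ≡⟨ ℤ.*-comm (+ k) (+ n) ⟩
      + n ℤ.* + k ∎

  burnside : (∑[ m < n ] ∑[ x < ℓ ℕ.^ n ] ⟦ fixed? (toℕ m) (finToFun x) ⟧) ≡ + n ℤ.* + OP (cycle n) (Rot n) ℓ μ
  burnside = burnside′ (to ∘ id) injective λ f → let (i , i≈) = surjective f in i , i≈ refl
    where open Bijection (coloringClasses-finite (cycle n) (Rot n) ℓ μ .proj₂)

-- Colorings fixed by a rotation as colorings of a shorter cycle.

Compatible : ∀ {ℓ} → ℕ → Fin ℓ → Fin ℓ → Set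
Compatible μ a b = a ≢ b ⊎ (a ≡ b × μ < color a)

compatible-sym : ∀ {ℓ μ} {a b : Fin ℓ} → Compatible μ a b → Compatible μ b a
compatible-sym (inj₁ a≢b)         = inj₁ (a≢b ∘ sym)
compatible-sym (inj₂ (refl , μ<)) = inj₂ (refl , μ<)

-- Each edge joins a vertex to its successor, and compatibility is symmetric, so one test per vertex
-- suffices. For n = 1 the successor of the vertex is itself and the test is the loop condition.
proper⇔compatible : ∀ n ℓ μ .{{_ : NonZero n}} {f : Fin n → Fin ℓ} →
                    IsProper (cycle n) ℓ μ f ⇔ (∀ v → Compatible μ (f v) (f (rotate n 1 v)))
proper⇔compatible n ℓ μ = mk⇔ (λ p v → p v _ (v , inj₁ refl)) λ where
  c v _ (v , inj₁ refl) → c v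
  c _ v (v , inj₂ refl) → compatible-sym (c v)

toℕ-mod : ∀ a n .{{_ : NonZero n}} → toℕ (a mod n) ≡ a % n
toℕ-mod a n = Fin.toℕ-fromℕ< (m%n<n a n)

module _ {n : ℕ} .{{_ : NonZero n}} (f : Fin n → Fin ℓ) where

  Period : ℕ → Set
  Period m = f ∘ rotate n m ≗ f

  period-+ : ∀ {a b} → Period a → Period b → Period (a ℕ.+ b)
  period-+ {a} {b} pa pb v = trans (cong f (sym (rotate-+ n a b v))) (trans (pb _) (pa v))

  period-cancel : ∀ {a b} → Period (a ℕ.+ b) → Period b → Period a
  period-cancel {a} {b} pab pb v = trans (sym (pb _)) (trans (cong f (rotate-+ n a b v)) (pab v))

  period-* : ∀ {a} q → Period a → Period (q ℕ.* a)
  period-* zero    pa v = cong f (Fin.toℕ-injective (trans (toℕ-rotate n 0 v)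
    (trans (cong (_% n) (ℕ.+-identityʳ (toℕ v))) (m<n⇒m%n≡m (Fin.toℕ<n v)))))
  period-* (suc q) pa   = period-+ pa (period-* q pa)

  -- The periods are closed under sums and differences and contain `n`, because rotation by `n` is
  -- the identity. Bézout then yields the gcd; its two cases say which multiple is the larger, since
  -- the difference must be taken in ℕ.
  period-gcd : ∀ {m d} → GCD m n d → Period m → Period d
  period-gcd {m} {d} g pm with Bézout.identity g
  ... | Bézout.+- x y eq = period-cancel (subst Period (sym eq) (period-* x pm)) (period-* y (cong f ∘ rotate-n n))
  ... | Bézout.-+ x y eq = period-cancel (subst Period (sym eq) (period-* y (cong f ∘ rotate-n n))) (period-* x pm)

module _ {n d : ℕ} .{{_ : NonZero n}} .{{_ : NonZero d}} (d∣n : d ∣ n) where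

  wrap : Fin n → Fin d
  wrap v = toℕ v mod d

  -- As `d ≤ n`, this is the inclusion of the first `d` vertices; `mod n` merely supplies the bound.
  unwrap : Fin d → Fin n
  unwrap u = toℕ u mod n

  wrap-unwrap : ∀ u → wrap (unwrap u) ≡ u
  wrap-unwrap u = Fin.toℕ-injective (begin
    toℕ (wrap (unwrap u)) ≡⟨ toℕ-mod (toℕ (unwrap u)) d ⟩
    toℕ (unwrap u) % d    ≡⟨ cong (_% d) (toℕ-mod (toℕ u) n) ⟩
    toℕ u % n % d         ≡⟨ m∣n⇒o%n%m≡o%m d n (toℕ u) d∣n ⟩
    toℕ u % d             ≡⟨ m<n⇒m%n≡m (Fin.toℕ<n u) ⟩
    toℕ u                 ∎)

  wrap-rotate : ∀ m v → wrap (rotate n m v) ≡ rotate d m (wrap v)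
  wrap-rotate m v = Fin.toℕ-injective (begin
    toℕ (wrap (rotate n m v)) ≡⟨ toℕ-mod (toℕ (rotate n m v)) d ⟩
    toℕ (rotate n m v) % d    ≡⟨ cong (_% d) (toℕ-rotate n m v) ⟩
    (toℕ v ℕ.+ m) % n % d     ≡⟨ m∣n⇒o%n%m≡o%m d n (toℕ v ℕ.+ m) d∣n ⟩
    (toℕ v ℕ.+ m) % d         ≡⟨ %-+ˡ d (toℕ v) m ⟨
    (toℕ v % d ℕ.+ m) % d     ≡⟨ cong (λ x → (x ℕ.+ m) % d) (toℕ-mod (toℕ v) d) ⟨
    (toℕ (wrap v) ℕ.+ m) % d  ≡⟨ toℕ-rotate d m (wrap v) ⟨
    toℕ (rotate d m (wrap v)) ∎)

  rotate-∣ : ∀ {m} → d ∣ m → ∀ u → rotate d m u ≡ u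
  rotate-∣ {m} d∣m u = Fin.toℕ-injective (begin
    toℕ (rotate d m u)  ≡⟨ toℕ-rotate d m u ⟩
    (toℕ u ℕ.+ m) % d   ≡⟨ %-remove-+ʳ (toℕ u) d∣m ⟩
    toℕ u % d           ≡⟨ m<n⇒m%n≡m (Fin.toℕ<n u) ⟩
    toℕ u               ∎)

  -- Division with remainder: `v` differs from its residue by a rotation through a multiple of `d`,
  -- which a coloring of period `d` does not see.
  unwrap-wrap : ∀ v → rotate n (toℕ v ℕ./ d ℕ.* d) (unwrap (wrap v)) ≡ v
  unwrap-wrap v = Fin.toℕ-injective (begin
    toℕ (rotate n q (unwrap (wrap v)))       ≡⟨ toℕ-rotate n q _ ⟩
    (toℕ (unwrap (wrap v)) ℕ.+ q) % n        ≡⟨ cong (λ x → (x ℕ.+ q) % n) (toℕ-mod _ n) ⟩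
    (toℕ (wrap v) % n ℕ.+ q) % n             ≡⟨ %-+ˡ n (toℕ (wrap v)) q ⟩
    (toℕ (wrap v) ℕ.+ q) % n                 ≡⟨ cong (λ x → (x ℕ.+ q) % n) (toℕ-mod (toℕ v) d) ⟩
    (toℕ v % d ℕ.+ q) % n                    ≡⟨ cong (_% n) (m≡m%n+[m/n]*n (toℕ v) d) ⟨
    toℕ v % n                                ≡⟨ m<n⇒m%n≡m (Fin.toℕ<n v) ⟩
    toℕ v                                    ∎)
    where q = toℕ v ℕ./ d ℕ.* d

  module _ {ℓ μ : ℕ} {f : Fin n → Fin ℓ} {g : Fin d → Fin ℓ} (f≗g∘wrap : f ≗ g ∘ wrap) where

    -- `wrap` is a covering of the short cycle by the long one: it takes successors to successors,
    -- and every vertex of the short cycle lifts together with its successor. So properness passes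
    -- in both directions.
    proper-wrap⁻ : IsProper (cycle n) ℓ μ f → IsProper (cycle d) ℓ μ g
    proper-wrap⁻ p = Equivalence.from (proper⇔compatible d ℓ μ) λ u →
      subst₂ (Compatible μ)
        (trans (f≗g∘wrap (unwrap u)) (cong g (wrap-unwrap u)))
        (trans (f≗g∘wrap (rotate n 1 (unwrap u)))
          (cong g (trans (wrap-rotate 1 (unwrap u)) (cong (rotate d 1) (wrap-unwrap u)))))
        (Equivalence.to (proper⇔compatible n ℓ μ) p (unwrap u))

    proper-wrap⁺ : IsProper (cycle d) ℓ μ g → IsProper (cycle n) ℓ μ f
    proper-wrap⁺ p = Equivalence.from (proper⇔compatible n ℓ μ) λ v →
      subst₂ (Compatible μ)
        (sym (f≗g∘wrap v))
        (sym (trans (f≗g∘wrap (rotate n 1 v)) (cong g (wrap-rotate 1 v))))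
        (Equivalence.to (proper⇔compatible d ℓ μ) p (wrap v))

-- A coloring fixed by rotation through `m` has period `d`, hence factors uniquely through `wrap`.
-- Conversely a pullback along `wrap` is fixed, because `d` divides `m`.
fixed-count : ∀ n d m ℓ μ .{{_ : NonZero n}} .{{_ : NonZero d}} → GCD m n d →
              (∑[ x < ℓ ℕ.^ n ] ⟦ fixed? n ℓ μ m (finToFun x) ⟧) ≡ (∑[ y < ℓ ℕ.^ d ] ⟦ proper? d ℓ μ (finToFun y) ⟧)
fixed-count n d m ℓ μ g = ∑-bijection {ℓ ℕ.^ n} {ℓ ℕ.^ d}
  (λ x → fixed? n ℓ μ m (finToFun x)) (λ y → proper? d ℓ μ (finToFun y))
  (λ x y → fixed? n ℓ μ m (finToFun x) ×-dec (finToFun x ≗? finToFun y ∘ wrap d∣n))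
  proj₁
  -- The factor through `wrap` is the restriction to the first `d` vertices.
  (λ {x} p → funToFin (finToFun x ∘ unwrap d∣n) , p , λ v → trans
    (trans (cong (finToFun x) (sym (unwrap-wrap d∣n v)))
           (period-* (finToFun x) (toℕ v ℕ./ d) (period-gcd (finToFun x) g (proj₂ p)) _))
    (sym (Fin.finToFun-funToFin (finToFun x ∘ unwrap d∣n) (wrap d∣n v))))
  (λ {x} {y} {y′} (_ , p) (_ , q) → finToFun-injective {ℓ} {d} λ u → trans
    (trans (cong (finToFun y) (sym (wrap-unwrap d∣n u))) (sym (p _)))
    (trans (q _) (cong (finToFun y′) (wrap-unwrap d∣n u))))
  (λ ((p , _) , eq) → proper-wrap⁻ d∣n eq p)
  (λ {y} p → funToFin (finToFun y ∘ wrap d∣n) ,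
    let eq : finToFun (funToFin (finToFun {ℓ} {d} y ∘ wrap d∣n)) ≗ finToFun y ∘ wrap d∣n
        eq = Fin.finToFun-funToFin (finToFun y ∘ wrap d∣n)
    in (proper-wrap⁺ d∣n eq p , λ v → trans (eq _) (trans (cong (finToFun y)
         (trans (wrap-rotate d∣n m v) (rotate-∣ d∣n (GCD.gcd∣m g) _))) (sym (eq v)))) , eq)
  (λ {x} {x′} {y} (_ , p) (_ , q) → finToFun-injective {ℓ} {n} λ v → trans (p v) (sym (q v)))
  where
  d∣n : d ∣ n
  d∣n = GCD.gcd∣n g

-- Sums over gcds as divisor sums.

-- Stated for `applyUpTo g` rather than `upTo`, since the induction replaces `g` by `g ∘ suc`.
foldr-filter-upTo : ∀ {P : ℕ → Set} (P? : Decidable P) (F : ℕ → ℤ) (g : ℕ → ℕ) n →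
  foldr ℤ._+_ 0ℤ (map F (filter P? (applyUpTo g n))) ≡ (∑[ i < n ] (⟦ P? (g (toℕ i)) ⟧ ℤ.* F (g (toℕ i))))
foldr-filter-upTo P? F g zero    = refl
foldr-filter-upTo P? F g (suc n) with P? (g 0)
... | yes _ = cong₂ ℤ._+_ (sym (ℤ.*-identityˡ (F (g 0)))) (foldr-filter-upTo P? F (g ∘ suc) n)
... | no  _ = trans (foldr-filter-upTo P? F (g ∘ suc) n) (sym (ℤ.+-identityˡ _))

length-filter-upTo : ∀ {P : ℕ → Set} (P? : Decidable P) (f g : ℕ → ℕ) n →
  + length (filter P? (map f (applyUpTo g n))) ≡ (∑[ i < n ] ⟦ P? (f (g (toℕ i))) ⟧)
length-filter-upTo P? f g zero    = refl
length-filter-upTo P? f g (suc n) with P? (f (g 0))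
... | yes _ = cong (ℤ._+_ 1ℤ) (length-filter-upTo P? f (g ∘ suc) n)
... | no  _ = trans (length-filter-upTo P? f (g ∘ suc) n) (sym (ℤ.+-identityˡ _))

-- The numbers in 1, ..., qd whose gcd with qd is d are the multiples jd with 1 ≤ j ≤ q and j
-- coprime to q.
gcd-count : ∀ q d .{{_ : NonZero d}} →
            (∑[ m < q ℕ.* d ] ⟦ gcd (suc (toℕ m)) (q ℕ.* d) ℕ.≟ d ⟧) ≡ + φ q
gcd-count q d@(suc d′) = trans
  (∑-bijection (λ m → gcd (suc (toℕ m)) (q ℕ.* d) ℕ.≟ d) (λ j → coprime? (suc (toℕ j)) q)
    (λ m j → (suc (toℕ m) ℕ.≟ suc (toℕ j) ℕ.* d) ×-dec coprime? (suc (toℕ j)) q)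
    (λ {m} {j} (eq , c) → begin
      gcd (suc (toℕ m)) (q ℕ.* d)               ≡⟨ cong (λ x → gcd x (q ℕ.* d)) eq ⟩
      gcd (suc (toℕ j) ℕ.* d) (q ℕ.* d)         ≡⟨ gcd-*ʳ (suc (toℕ j)) ⟩
      gcd (suc (toℕ j)) q ℕ.* d                 ≡⟨ cong (ℕ._* d) (coprime⇒gcd≡1 c) ⟩
      1 ℕ.* d                                   ≡⟨ ℕ.*-identityˡ d ⟩
      d                                         ∎)
    (λ {m} eq → quotient m (subst (_∣ suc (toℕ m)) eq (gcd[m,n]∣m (suc (toℕ m)) (q ℕ.* d))) eq)
    (λ {m} {j} {j′} (p , _) (p′ , _) → Fin.toℕ-injective (ℕ.suc-injective
      (ℕ.*-cancelʳ-≡ (suc (toℕ j)) (suc (toℕ j′)) d (trans (sym p) p′))))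
    proj₂
    (λ {j} c → fromℕ< (ℕ.*-monoˡ-≤ d (Fin.toℕ<n j)) , cong suc (Fin.toℕ-fromℕ< _) , c)
    (λ (p , _) (p′ , _) → Fin.toℕ-injective (ℕ.suc-injective (trans p (sym p′)))))
  (sym (length-filter-upTo (λ k → coprime? k q) suc id q))
  where
  gcd-*ʳ : ∀ a → gcd (a ℕ.* d) (q ℕ.* d) ≡ gcd a q ℕ.* d
  gcd-*ʳ a = trans (cong₂ gcd (ℕ.*-comm a d) (ℕ.*-comm q d))
    (trans (sym (c*gcd[m,n]≡gcd[cm,cn] d a q)) (ℕ.*-comm d (gcd a q)))

  quotient : (m : Fin (q ℕ.* d)) → d ∣ suc (toℕ m) → gcd (suc (toℕ m)) (q ℕ.* d) ≡ d →
             ∃ λ (j : Fin q) → suc (toℕ m) ≡ suc (toℕ j) ℕ.* d × Coprime (suc (toℕ j)) q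
  -- The quotient is a successor because `suc (toℕ m)` is positive; cancelling `d` bounds it by `q`.
  quotient m (divides (suc j) eq) gcd≡d = fromℕ< j<q
    , trans eq (cong (λ x → suc x ℕ.* d) (sym (Fin.toℕ-fromℕ< j<q)))
    , subst (λ x → Coprime (suc x) q) (sym (Fin.toℕ-fromℕ< j<q))
        (gcd≡1⇒coprime (ℕ.*-cancelʳ-≡ (gcd (suc j) q) 1 d (begin
          gcd (suc j) q ℕ.* d             ≡⟨ gcd-*ʳ (suc j) ⟨
          gcd (suc j ℕ.* d) (q ℕ.* d)     ≡⟨ cong (λ x → gcd x (q ℕ.* d)) eq ⟨
          gcd (suc (toℕ m)) (q ℕ.* d)     ≡⟨ gcd≡d ⟩
          d                               ≡⟨ ℕ.*-identityˡ d ⟨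
          1 ℕ.* d                         ∎)))
    where
    j<q : j < q
    j<q = ℕ.*-cancelʳ-≤ (suc j) q d (subst (_≤ q ℕ.* d) eq (Fin.toℕ<n m))

-- Group the indices by the value d of the gcd: the group has φ(n/d) members if d divides n and is
-- empty otherwise.
∑-gcd : ∀ n .{{_ : NonZero n}} (F : ℕ → ℤ) →
        (∑[ m < n ] F (gcd (suc (toℕ m)) n)) ≡ ∑-divisors n (λ d → + φ (n ℕ./ d) ℤ.* F d)
∑-gcd n F = begin
  ∑[ m < n ] F (gcd (suc (toℕ m)) n)
    ≡⟨ sum-cong-≗ expand ⟩
  ∑[ m < n ] ∑[ i < n ] (⟦ gcd (suc (toℕ m)) n ℕ.≟ suc (toℕ i) ⟧ ℤ.* F (suc (toℕ i)))
    ≡⟨ ∑-comm {n} {n} (λ m i → ⟦ gcd (suc (toℕ m)) n ℕ.≟ suc (toℕ i) ⟧ ℤ.* F (suc (toℕ i))) ⟩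
  ∑[ i < n ] ∑[ m < n ] (⟦ gcd (suc (toℕ m)) n ℕ.≟ suc (toℕ i) ⟧ ℤ.* F (suc (toℕ i)))
    ≡⟨ sum-cong-≗ {n} (λ i → collect (toℕ i)) ⟩
  ∑[ i < n ] (⟦ suc (toℕ i) ∣? n ⟧ ℤ.* (+ φ (n ℕ./ suc (toℕ i)) ℤ.* F (suc (toℕ i))))
    ≡⟨ foldr-filter-upTo (λ i → suc i ∣? n) (λ i → + φ (n ℕ./ suc i) ℤ.* F (suc i)) id n ⟨
  ∑-divisors n (λ d → + φ (n ℕ./ d) ℤ.* F d) ∎
  where
  expand : (m : Fin n) → F (gcd (suc (toℕ m)) n) ≡ (∑[ i < n ] (⟦ gcd (suc (toℕ m)) n ℕ.≟ suc (toℕ i) ⟧ ℤ.* F (suc (toℕ i))))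
  expand m with gcd (suc (toℕ m)) n in eq | gcd[m,n]≤n (suc (toℕ m)) n
  ... | zero  | _   = contradiction eq (gcd[m,n]≢0 (suc (toℕ m)) n (inj₁ λ ()))
  ... | suc d | d<n = sym (begin
    ∑[ i < n ] (⟦ suc d ℕ.≟ suc (toℕ i) ⟧ ℤ.* F (suc (toℕ i)))
      ≡⟨ ∑-single _ (fromℕ< d<n) (λ j j≢ → cong (ℤ._* F (suc (toℕ j)))
           (⟦⟧-no (suc d ℕ.≟ suc (toℕ j)) λ e → j≢ (Fin.toℕ-injective
             (trans (sym (ℕ.suc-injective e)) (sym (Fin.toℕ-fromℕ< d<n)))))) ⟩
    ⟦ suc d ℕ.≟ suc (toℕ (fromℕ< d<n)) ⟧ ℤ.* F (suc (toℕ (fromℕ< d<n)))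
      ≡⟨ cong (λ x → ⟦ suc d ℕ.≟ suc x ⟧ ℤ.* F (suc x)) (Fin.toℕ-fromℕ< d<n) ⟩
    ⟦ suc d ℕ.≟ suc d ⟧ ℤ.* F (suc d)
      ≡⟨ cong (ℤ._* F (suc d)) (⟦⟧-yes (suc d ℕ.≟ suc d) refl) ⟩
    1ℤ ℤ.* F (suc d)
      ≡⟨ ℤ.*-identityˡ (F (suc d)) ⟩
    F (suc d) ∎)

  count : ∀ i (d∣n? : Dec (suc i ∣ n)) →
          (∑[ m < n ] ⟦ gcd (suc (toℕ m)) n ℕ.≟ suc i ⟧) ≡ ⟦ d∣n? ⟧ ℤ.* + φ (n ℕ./ suc i)
  count i (yes (divides q refl)) = trans (gcd-count q (suc i))
    (trans (cong (λ x → + φ x) (sym (m*n/n≡m q (suc i)))) (sym (ℤ.*-identityˡ _)))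
  count i (no d∤n) = ∑-zero {n} _ λ m → ⟦⟧-no (gcd (suc (toℕ m)) n ℕ.≟ suc i) λ eq →
    d∤n (subst (_∣ n) eq (gcd[m,n]∣n (suc (toℕ m)) n))

  collect : ∀ i → (∑[ m < n ] (⟦ gcd (suc (toℕ m)) n ℕ.≟ suc i ⟧ ℤ.* F (suc i)))
                  ≡ ⟦ suc i ∣? n ⟧ ℤ.* (+ φ (n ℕ./ suc i) ℤ.* F (suc i))
  collect i = begin
    ∑[ m < n ] (⟦ gcd (suc (toℕ m)) n ℕ.≟ suc i ⟧ ℤ.* F (suc i))
      ≡⟨ *-distribʳ-sum {n} (F (suc i)) (λ m → ⟦ gcd (suc (toℕ m)) n ℕ.≟ suc i ⟧) ⟨
    (∑[ m < n ] ⟦ gcd (suc (toℕ m)) n ℕ.≟ suc i ⟧) ℤ.* F (suc i)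
      ≡⟨ cong (ℤ._* F (suc i)) (count i (suc i ∣? n)) ⟩
    ⟦ suc i ∣? n ⟧ ℤ.* + φ (n ℕ./ suc i) ℤ.* F (suc i)
      ≡⟨ ℤ.*-assoc ⟦ suc i ∣? n ⟧ (+ φ (n ℕ./ suc i)) (F (suc i)) ⟩
    ⟦ suc i ∣? n ⟧ ℤ.* (+ φ (n ℕ./ suc i) ℤ.* F (suc i)) ∎

-- Proper colorings as closed walks.

snoc : ∀ {k} → (Fin k → A) → A → Fin (suc k) → A
snoc {k = zero}  f b zero    = b
snoc {k = suc k} f b zero    = f zero
snoc {k = suc k} f b (suc i) = snoc (f ∘ suc) b i

snoc-inject₁ : ∀ {k} (f : Fin k → A) b i → snoc f b (inject₁ i) ≡ f i
snoc-inject₁ f b zero    = refl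
snoc-inject₁ f b (suc i) = snoc-inject₁ (f ∘ suc) b i

snoc-fromℕ : ∀ {k} (f : Fin k → A) b → snoc f b (fromℕ k) ≡ b
snoc-fromℕ {k = zero}  f b = refl
snoc-fromℕ {k = suc k} f b = snoc-fromℕ (f ∘ suc) b

-- Cuts the cycle open: with the first color repeated at the end, cyclic successors become
-- consecutive positions. Only the last position wraps round to 0.
snoc-rotate : ∀ {k} (f : Fin (suc k) → A) i → snoc (f ∘ suc) (f zero) i ≡ f (rotate (suc k) 1 i)
snoc-rotate {k = k} f i with view i
... | ‵fromℕ     = trans (snoc-fromℕ (f ∘ suc) (f zero)) (cong f (Fin.toℕ-injective (begin
  0                                         ≡⟨ n%n≡0 (suc k) ⟨
  suc k % suc k                             ≡⟨ cong (λ x → suc x % suc k) (Fin.toℕ-fromℕ k) ⟨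
  suc (toℕ (fromℕ k)) % suc k               ≡⟨ cong (_% suc k) (ℕ.+-comm 1 (toℕ (fromℕ k))) ⟩
  (toℕ (fromℕ k) ℕ.+ 1) % suc k             ≡⟨ toℕ-rotate (suc k) 1 (fromℕ k) ⟨
  toℕ (rotate (suc k) 1 (fromℕ k))          ∎)))
... | ‵inject₁ j = trans (snoc-inject₁ (f ∘ suc) (f zero) j) (cong f (Fin.toℕ-injective (begin
  suc (toℕ j)                               ≡⟨ m<n⇒m%n≡m (s≤s (Fin.toℕ<n j)) ⟨
  suc (toℕ j) % suc k                       ≡⟨ cong (λ x → suc x % suc k) (Fin.toℕ-inject₁ j) ⟨
  suc (toℕ (inject₁ j)) % suc k             ≡⟨ cong (_% suc k) (ℕ.+-comm 1 (toℕ (inject₁ j))) ⟩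
  (toℕ (inject₁ j) ℕ.+ 1) % suc k           ≡⟨ toℕ-rotate (suc k) 1 (inject₁ j) ⟨
  toℕ (rotate (suc k) 1 (inject₁ j))        ∎)))

-- Splits off the leading base-ℓ digit of a code. `finToFun z ∘ suc` is definitionally `finToFun` of
-- the remaining digits, so `h` need not respect pointwise equality.
∑-finToFun : ∀ ℓ k (h : Fin ℓ → (Fin k → Fin ℓ) → ℤ) →
  (∑[ z < ℓ ℕ.^ suc k ] h (finToFun {ℓ} {suc k} z zero) (finToFun {ℓ} {suc k} z ∘ suc)) ≡ (∑[ c < ℓ ] ∑[ y < ℓ ℕ.^ k ] h c (finToFun y))
∑-finToFun ℓ k h = trans (∑-combine ℓ (λ z → h (finToFun {ℓ} {suc k} z zero) (finToFun {ℓ} {suc k} z ∘ suc)))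
  (sum-cong-≗ {ℓ} λ c → sum-cong-≗ {ℓ ℕ.^ k} λ y →
    cong (λ p → h (proj₁ p) (finToFun (proj₂ p))) (Fin.remQuot-combine c y))

module _ (ℓ μ : ℕ) where

  compatible? : (a b : Fin ℓ) → Dec (Compatible μ a b)
  compatible? a b = ¬? (a Fin.≟ b) ⊎-dec ((a Fin.≟ b) ×-dec (μ ℕ.<? color a))

  -- The diagonal of the projection D of the overview. Colors start at 1, so `toℕ a < μ` means
  -- `color a ≤ μ`.
  low : Fin ℓ → ℤ
  low a = ⟦ toℕ a ℕ.<? μ ⟧

  -- The entries of A = J - D: the only forbidden pairs consist of twice the same low color.
  compatible-low : ∀ a b → ⟦ compatible? a b ⟧ ≡ 1ℤ ℤ.- low a ℤ.* ⟦ a Fin.≟ b ⟧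
  compatible-low a b = cases (a Fin.≟ b)
    where
    cases : Dec (a ≡ b) → ⟦ compatible? a b ⟧ ≡ 1ℤ ℤ.- low a ℤ.* ⟦ a Fin.≟ b ⟧
    cases (no a≢b) = trans (⟦⟧-yes (compatible? a b) (inj₁ a≢b))
      (sym (trans (cong (λ x → 1ℤ ℤ.- low a ℤ.* x) (⟦⟧-no (a Fin.≟ b) a≢b))
                  (cong (ℤ._-_ 1ℤ) (ℤ.*-zeroʳ (low a)))))
    cases (yes refl) = trans (by-level (toℕ a ℕ.<? μ))
      (cong (ℤ._-_ 1ℤ) (sym (trans (cong (ℤ._*_ (low a)) (⟦⟧-yes (a Fin.≟ a) refl)) (ℤ.*-identityʳ (low a)))))
      where
      by-level : Dec (toℕ a < μ) → ⟦ compatible? a a ⟧ ≡ 1ℤ ℤ.- low a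
      by-level (yes a<μ) = trans
        (⟦⟧-no (compatible? a a) λ { (inj₁ a≢a) → a≢a refl ; (inj₂ (_ , μ≤a)) → ℕ.<⇒≱ a<μ (ℕ.≤-pred μ≤a) })
        (cong (ℤ._-_ 1ℤ) (sym (⟦⟧-yes (toℕ a ℕ.<? μ) a<μ)))
      by-level (no a≮μ) = trans
        (⟦⟧-yes (compatible? a a) (inj₂ (refl , s≤s (ℕ.≮⇒≥ a≮μ))))
        (cong (ℤ._-_ 1ℤ) (sym (⟦⟧-no (toℕ a ℕ.<? μ) a≮μ)))

  -- `f` lists the `k` interior vertices, so the walk has `k + 1` steps; hence the shift to
  -- `walks (suc k)` below.
  Walk : ∀ k → Fin ℓ → (Fin k → Fin ℓ) → Fin ℓ → Set
  Walk zero    a f b = Compatible μ a b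
  Walk (suc k) a f b = Compatible μ a (f zero) × Walk k (f zero) (f ∘ suc) b

  walk? : ∀ k a f b → Dec (Walk k a f b)
  walk? zero    a f b = compatible? a b
  walk? (suc k) a f b = compatible? a (f zero) ×-dec walk? k (f zero) (f ∘ suc) b

  walk⇔snoc : ∀ k (f : Fin (suc k) → Fin ℓ) b →
              Walk k (f zero) (f ∘ suc) b ⇔ (∀ i → Compatible μ (f i) (snoc (f ∘ suc) b i))
  walk⇔snoc zero    f b = mk⇔ (λ { c zero → c }) (λ c → c zero)
  walk⇔snoc (suc k) f b = mk⇔
    (λ { (c , w) zero → c ; (c , w) (suc i) → Equivalence.to (walk⇔snoc k (f ∘ suc) b) w i })
    (λ c → c zero , Equivalence.from (walk⇔snoc k (f ∘ suc) b) (c ∘ suc))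

  closed-walk⇔proper : ∀ k (f : Fin (suc k) → Fin ℓ) →
                       IsProper (cycle (suc k)) ℓ μ f ⇔ Walk k (f zero) (f ∘ suc) (f zero)
  closed-walk⇔proper k f = mk⇔
    (λ p → Equivalence.from (walk⇔snoc k f (f zero)) λ i →
      subst (Compatible μ (f i)) (sym (snoc-rotate f i)) (Equivalence.to (proper⇔compatible (suc k) ℓ μ) p i))
    (λ w → Equivalence.from (proper⇔compatible (suc k) ℓ μ) λ i →
      subst (Compatible μ (f i)) (snoc-rotate f i) (Equivalence.to (walk⇔snoc k f (f zero)) w i))

  -- The entries of the power A^k.
  walks : ℕ → Fin ℓ → Fin ℓ → ℤ
  walks zero    a b = ⟦ a Fin.≟ b ⟧
  walks (suc k) a b = ∑[ c < ℓ ] (⟦ compatible? a c ⟧ ℤ.* walks k c b)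

  walk-count : ∀ k a b → (∑[ y < ℓ ℕ.^ k ] ⟦ walk? k a (finToFun y) b ⟧) ≡ walks (suc k) a b
  walk-count zero a b = begin
    ⟦ compatible? a b ⟧ ℤ.+ 0ℤ
      ≡⟨ ℤ.+-identityʳ ⟦ compatible? a b ⟧ ⟩
    ⟦ compatible? a b ⟧
      ≡⟨ ℤ.*-identityʳ ⟦ compatible? a b ⟧ ⟨
    ⟦ compatible? a b ⟧ ℤ.* 1ℤ
      ≡⟨ cong (ℤ._*_ ⟦ compatible? a b ⟧) (⟦⟧-yes (b Fin.≟ b) refl) ⟨
    ⟦ compatible? a b ⟧ ℤ.* ⟦ b Fin.≟ b ⟧
      ≡⟨ ∑-single (λ c → ⟦ compatible? a c ⟧ ℤ.* ⟦ c Fin.≟ b ⟧) b (λ c c≢b →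
           trans (cong (ℤ._*_ ⟦ compatible? a c ⟧) (⟦⟧-no (c Fin.≟ b) c≢b)) (ℤ.*-zeroʳ ⟦ compatible? a c ⟧)) ⟨
    walks 1 a b ∎
  walk-count (suc k) a b = begin
    ∑[ z < ℓ ℕ.^ suc k ] ⟦ walk? (suc k) a (finToFun z) b ⟧
      ≡⟨ ∑-finToFun ℓ k (λ c f → ⟦ compatible? a c ×-dec walk? k c f b ⟧) ⟩
    ∑[ c < ℓ ] ∑[ y < ℓ ℕ.^ k ] ⟦ compatible? a c ×-dec walk? k c (finToFun y) b ⟧
      ≡⟨ sum-cong-≗ {ℓ} (λ c → begin
           ∑[ y < ℓ ℕ.^ k ] ⟦ compatible? a c ×-dec walk? k c (finToFun y) b ⟧
             ≡⟨ sum-cong-≗ {ℓ ℕ.^ k} (λ y → ⟦⟧-× (compatible? a c) (walk? k c (finToFun y) b)) ⟩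
           ∑[ y < ℓ ℕ.^ k ] (⟦ compatible? a c ⟧ ℤ.* ⟦ walk? k c (finToFun y) b ⟧)
             ≡⟨ *-distribˡ-sum {ℓ ℕ.^ k} ⟦ compatible? a c ⟧ (λ y → ⟦ walk? k c (finToFun y) b ⟧) ⟨
           ⟦ compatible? a c ⟧ ℤ.* (∑[ y < ℓ ℕ.^ k ] ⟦ walk? k c (finToFun y) b ⟧)
             ≡⟨ cong (ℤ._*_ ⟦ compatible? a c ⟧) (walk-count k c b) ⟩
           ⟦ compatible? a c ⟧ ℤ.* walks (suc k) c b ∎) ⟩
    walks (suc (suc k)) a b ∎

  proper-count : ∀ k → (∑[ x < ℓ ℕ.^ suc k ] ⟦ proper? (suc k) ℓ μ (finToFun x) ⟧) ≡ (∑[ a < ℓ ] walks (suc k) a a)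
  proper-count k = begin
    ∑[ x < ℓ ℕ.^ suc k ] ⟦ proper? (suc k) ℓ μ (finToFun x) ⟧
      ≡⟨ sum-cong-≗ {ℓ ℕ.^ suc k} (λ x → ⟦⟧-cong (closed-walk⇔proper k (finToFun x)) (proper? (suc k) ℓ μ (finToFun x))
           (walk? k (finToFun {ℓ} {suc k} x zero) (finToFun {ℓ} {suc k} x ∘ suc) (finToFun {ℓ} {suc k} x zero))) ⟩
    ∑[ x < ℓ ℕ.^ suc k ] ⟦ walk? k (finToFun {ℓ} {suc k} x zero) (finToFun {ℓ} {suc k} x ∘ suc) (finToFun {ℓ} {suc k} x zero) ⟧
      ≡⟨ ∑-finToFun ℓ k (λ c f → ⟦ walk? k c f c ⟧) ⟩
    ∑[ a < ℓ ] ∑[ y < ℓ ℕ.^ k ] ⟦ walk? k a (finToFun y) a ⟧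
      ≡⟨ sum-cong-≗ {ℓ} (λ a → walk-count k a a) ⟩
    ∑[ a < ℓ ] walks (suc k) a a ∎

-- Sequences with a Lucas recurrence.

LucasRecurrence : ℤ → ℤ → (ℕ → ℤ) → Set
LucasRecurrence P Q f = ∀ k → f (suc (suc k)) ≡ P ℤ.* f (suc k) ℤ.- Q ℤ.* f k

lucas-unique : ∀ {P Q f g} → LucasRecurrence P Q f → LucasRecurrence P Q g →
               f 0 ≡ g 0 → f 1 ≡ g 1 → ∀ k → f k ≡ g k
lucas-unique {P} {Q} {f} {g} rf rg eq₀ eq₁ k = proj₁ (both k)
  where
  both : ∀ k → f k ≡ g k × f (suc k) ≡ g (suc k)
  both zero    = eq₀ , eq₁
  both (suc k) = let (p , q) = both k in
    q , trans (rf k) (trans (cong₂ (λ x y → P ℤ.* x ℤ.- Q ℤ.* y) q p) (sym (rg k)))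

lucas-combine : ∀ {P Q f} → LucasRecurrence P Q f → LucasRecurrence P Q (λ k → f (suc k) ℤ.+ f k)
lucas-combine {P} {Q} {f} rf k = trans (cong₂ ℤ._+_ (rf (suc k)) (rf k)) (lemma P Q (f (suc (suc k))) (f (suc k)) (f k))
  where
  lemma : ∀ P Q x y z → (P ℤ.* x ℤ.- Q ℤ.* y) ℤ.+ (P ℤ.* y ℤ.- Q ℤ.* z) ≡ P ℤ.* (x ℤ.+ y) ℤ.- Q ℤ.* (y ℤ.+ z)
  lemma = solve-∀

lucas-minus : ∀ {P Q f g} → LucasRecurrence P Q f → LucasRecurrence P Q g → LucasRecurrence P Q (λ k → f k ℤ.- g k)
lucas-minus {P} {Q} {f} {g} rf rg k = trans (cong₂ ℤ._-_ (rf k) (rg k)) (lemma P Q (f (suc k)) (f k) (g (suc k)) (g k))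
  where
  lemma : ∀ P Q x y z w → (P ℤ.* x ℤ.- Q ℤ.* y) ℤ.- (P ℤ.* z ℤ.- Q ℤ.* w) ≡ P ℤ.* (x ℤ.- z) ℤ.- Q ℤ.* (y ℤ.- w)
  lemma = solve-∀

lucas-∑ : ∀ {n P Q} (h : Fin n → ℤ) {f : ℕ → Fin n → ℤ} → (∀ i → LucasRecurrence P Q (λ k → f k i)) →
          LucasRecurrence P Q (λ k → ∑[ i < n ] (h i ℤ.* f k i))
lucas-∑ {n} {P} {Q} h {f} rf k = begin
  ∑[ i < n ] (h i ℤ.* f (suc (suc k)) i)
    ≡⟨ sum-cong-≗ (λ i → trans (cong (ℤ._*_ (h i)) (rf i k)) (lemma P Q (h i) (f (suc k) i) (f k i))) ⟩
  ∑[ i < n ] (P ℤ.* (h i ℤ.* f (suc k) i) ℤ.- Q ℤ.* (h i ℤ.* f k i))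
    ≡⟨ ∑-minus {n} (λ i → P ℤ.* (h i ℤ.* f (suc k) i)) (λ i → Q ℤ.* (h i ℤ.* f k i)) ⟩
  (∑[ i < n ] (P ℤ.* (h i ℤ.* f (suc k) i))) ℤ.- (∑[ i < n ] (Q ℤ.* (h i ℤ.* f k i)))
    ≡⟨ cong₂ ℤ._-_ (*-distribˡ-sum P (λ i → h i ℤ.* f (suc k) i)) (*-distribˡ-sum Q (λ i → h i ℤ.* f k i)) ⟨
  P ℤ.* (∑[ i < n ] (h i ℤ.* f (suc k) i)) ℤ.- Q ℤ.* (∑[ i < n ] (h i ℤ.* f k i)) ∎
  where
  lemma : ∀ P Q h x y → h ℤ.* (P ℤ.* x ℤ.- Q ℤ.* y) ≡ P ℤ.* (h ℤ.* x) ℤ.- Q ℤ.* (h ℤ.* y)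
  lemma = solve-∀

-- The trace of the powers of A.

-- The trace of D. This is where `μ ≤ ℓ` enters the computation.
∑-low : ∀ {ℓ μ} → μ ≤ ℓ → (∑[ a < ℓ ] low ℓ μ a) ≡ + μ
∑-low {ℓ} {zero} _ = ∑-zero {ℓ} _ λ a → refl
∑-low {suc ℓ} {suc μ} (s≤s μ≤ℓ) = cong (ℤ._+_ 1ℤ) (trans
  (sum-cong-≗ {ℓ} λ a → ⟦⟧-cong (mk⇔ ℕ.≤-pred s≤s) (suc (toℕ a) ℕ.<? suc μ) (toℕ a ℕ.<? μ)) (∑-low {ℓ} μ≤ℓ))

low-idem : ∀ {ℓ} μ (a : Fin ℓ) → low ℓ μ a ℤ.* low ℓ μ a ≡ low ℓ μ a
low-idem μ a with does (toℕ a ℕ.<? μ)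
... | true  = refl
... | false = refl

module _ {ℓ μ : ℕ} (μ≤ℓ : μ ≤ ℓ) where

  private
    P = + ℓ ℤ.- 1ℤ
    Q = + μ ℤ.- + ℓ
    V = lucasV P Q
    lo : Fin ℓ → ℤ
    lo = low ℓ μ

  -- With 1 the all-ones vector, these are the row vectors 1ᵀ A^k and 1ᵀ D A^k. Passing to k + 1
  -- gives linear combinations of the same two.
  columnSum lowColumnSum : ℕ → Fin ℓ → ℤ
  columnSum    k b = ∑[ a < ℓ ] walks ℓ μ k a b
  lowColumnSum k b = ∑[ a < ℓ ] (lo a ℤ.* walks ℓ μ k a b)

  -- A^(k+1) = J A^k - D A^k, where the J-term depends on the column alone.
  walks-suc : ∀ k a b → walks ℓ μ (suc k) a b ≡ columnSum k b ℤ.- lo a ℤ.* walks ℓ μ k a b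
  walks-suc k a b = begin
    ∑[ c < ℓ ] (⟦ compatible? ℓ μ a c ⟧ ℤ.* p c)
      ≡⟨ sum-cong-≗ (λ c → trans (cong (ℤ._* p c) (compatible-low ℓ μ a c)) (lemma (lo a) ⟦ a Fin.≟ c ⟧ (p c))) ⟩
    ∑[ c < ℓ ] (p c ℤ.- lo a ℤ.* (⟦ a Fin.≟ c ⟧ ℤ.* p c))
      ≡⟨ ∑-minus p (λ c → lo a ℤ.* (⟦ a Fin.≟ c ⟧ ℤ.* p c)) ⟩
    columnSum k b ℤ.- (∑[ c < ℓ ] (lo a ℤ.* (⟦ a Fin.≟ c ⟧ ℤ.* p c)))
      ≡⟨ cong (ℤ._-_ (columnSum k b)) (begin
           ∑[ c < ℓ ] (lo a ℤ.* (⟦ a Fin.≟ c ⟧ ℤ.* p c))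
             ≡⟨ ∑-single (λ c → lo a ℤ.* (⟦ a Fin.≟ c ⟧ ℤ.* p c)) a (λ c c≢a →
                  trans (cong (λ x → lo a ℤ.* (x ℤ.* p c)) (⟦⟧-no (a Fin.≟ c) (c≢a ∘ sym))) (ℤ.*-zeroʳ (lo a))) ⟩
           lo a ℤ.* (⟦ a Fin.≟ a ⟧ ℤ.* p a)
             ≡⟨ cong (λ x → lo a ℤ.* (x ℤ.* p a)) (⟦⟧-yes (a Fin.≟ a) refl) ⟩
           lo a ℤ.* (1ℤ ℤ.* p a)
             ≡⟨ cong (ℤ._*_ (lo a)) (ℤ.*-identityˡ (p a)) ⟩
           lo a ℤ.* p a ∎) ⟩
    columnSum k b ℤ.- lo a ℤ.* p a ∎
    where
    p : Fin ℓ → ℤ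
    p c = walks ℓ μ k c b
    lemma : ∀ l e p → (1ℤ ℤ.- l ℤ.* e) ℤ.* p ≡ p ℤ.- l ℤ.* (e ℤ.* p)
    lemma = solve-∀

  columnSum-suc : ∀ k b → columnSum (suc k) b ≡ + ℓ ℤ.* columnSum k b ℤ.- lowColumnSum k b
  columnSum-suc k b = begin
    columnSum (suc k) b
      ≡⟨ sum-cong-≗ (λ a → walks-suc k a b) ⟩
    ∑[ a < ℓ ] (columnSum k b ℤ.- lo a ℤ.* walks ℓ μ k a b)
      ≡⟨ ∑-minus {ℓ} (λ _ → columnSum k b) (λ a → lo a ℤ.* walks ℓ μ k a b) ⟩
    (∑[ a < ℓ ] columnSum k b) ℤ.- lowColumnSum k b
      ≡⟨ cong (ℤ._- lowColumnSum k b) (∑-const ℓ (columnSum k b)) ⟩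
    + ℓ ℤ.* columnSum k b ℤ.- lowColumnSum k b ∎

  low-*-suc : ∀ k a b → lo a ℤ.* walks ℓ μ (suc k) a b ≡ columnSum k b ℤ.* lo a ℤ.- lo a ℤ.* walks ℓ μ k a b
  low-*-suc k a b = begin
    lo a ℤ.* walks ℓ μ (suc k) a b                 ≡⟨ cong (ℤ._*_ (lo a)) (walks-suc k a b) ⟩
    lo a ℤ.* (S ℤ.- lo a ℤ.* p)                    ≡⟨ lemma (lo a) S p ⟩
    S ℤ.* lo a ℤ.- lo a ℤ.* lo a ℤ.* p             ≡⟨ cong (λ x → S ℤ.* lo a ℤ.- x ℤ.* p) (low-idem μ a) ⟩
    S ℤ.* lo a ℤ.- lo a ℤ.* p                      ∎
    where
    S = columnSum k b
    p = walks ℓ μ k a b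
    lemma : ∀ l S p → l ℤ.* (S ℤ.- l ℤ.* p) ≡ S ℤ.* l ℤ.- l ℤ.* l ℤ.* p
    lemma = solve-∀

  lowColumnSum-suc : ∀ k b → lowColumnSum (suc k) b ≡ + μ ℤ.* columnSum k b ℤ.- lowColumnSum k b
  lowColumnSum-suc k b = begin
    lowColumnSum (suc k) b
      ≡⟨ sum-cong-≗ (λ a → low-*-suc k a b) ⟩
    ∑[ a < ℓ ] (columnSum k b ℤ.* lo a ℤ.- lo a ℤ.* walks ℓ μ k a b)
      ≡⟨ ∑-minus (λ a → columnSum k b ℤ.* lo a) (λ a → lo a ℤ.* walks ℓ μ k a b) ⟩
    (∑[ a < ℓ ] (columnSum k b ℤ.* lo a)) ℤ.- lowColumnSum k b
      ≡⟨ cong (ℤ._- lowColumnSum k b) (begin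
           ∑[ a < ℓ ] (columnSum k b ℤ.* lo a)  ≡⟨ *-distribˡ-sum (columnSum k b) lo ⟨
           columnSum k b ℤ.* sum lo             ≡⟨ cong (ℤ._*_ (columnSum k b)) (∑-low μ≤ℓ) ⟩
           columnSum k b ℤ.* + μ                ≡⟨ ℤ.*-comm (columnSum k b) (+ μ) ⟩
           + μ ℤ.* columnSum k b                ∎) ⟩
    + μ ℤ.* columnSum k b ℤ.- lowColumnSum k b ∎

  -- The pair of column sum and low column sum evolves by the matrix with rows (ℓ, -1) and (μ, -1),
  -- of trace `P` and determinant `Q`. The recurrence is Cayley-Hamilton for that matrix.
  columnSum-lucas : ∀ b → LucasRecurrence P Q (λ k → columnSum k b)
  columnSum-lucas b k = begin
    columnSum (suc (suc k)) b
      ≡⟨ columnSum-suc (suc k) b ⟩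
    + ℓ ℤ.* columnSum (suc k) b ℤ.- lowColumnSum (suc k) b
      ≡⟨ cong₂ (λ x y → + ℓ ℤ.* x ℤ.- y) (columnSum-suc k b) (lowColumnSum-suc k b) ⟩
    + ℓ ℤ.* (+ ℓ ℤ.* S ℤ.- M) ℤ.- (+ μ ℤ.* S ℤ.- M)
      ≡⟨ lemma (+ ℓ) (+ μ) S M ⟩
    P ℤ.* (+ ℓ ℤ.* S ℤ.- M) ℤ.- Q ℤ.* S
      ≡⟨ cong (λ x → P ℤ.* x ℤ.- Q ℤ.* S) (columnSum-suc k b) ⟨
    P ℤ.* columnSum (suc k) b ℤ.- Q ℤ.* S ∎
    where
    S = columnSum k b
    M = lowColumnSum k b
    lemma : ∀ l m S M → l ℤ.* (l ℤ.* S ℤ.- M) ℤ.- (m ℤ.* S ℤ.- M) ≡ (l ℤ.- 1ℤ) ℤ.* (l ℤ.* S ℤ.- M) ℤ.- (m ℤ.- l) ℤ.* S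
    lemma = solve-∀

  columnSum-0 : ∀ b → columnSum 0 b ≡ 1ℤ
  columnSum-0 b = trans (∑-single (λ a → ⟦ a Fin.≟ b ⟧) b (λ a a≢b → ⟦⟧-no (a Fin.≟ b) a≢b)) (⟦⟧-yes (b Fin.≟ b) refl)

  columnSum-1 : ∀ b → columnSum 1 b ≡ + ℓ ℤ.- lo b
  columnSum-1 b = begin
    columnSum 1 b                                 ≡⟨ columnSum-suc 0 b ⟩
    + ℓ ℤ.* columnSum 0 b ℤ.- lowColumnSum 0 b    ≡⟨ cong₂ (λ x y → + ℓ ℤ.* x ℤ.- y) (columnSum-0 b)
      (trans (∑-single (λ a → lo a ℤ.* ⟦ a Fin.≟ b ⟧) b
               (λ a a≢b → trans (cong (ℤ._*_ (lo a)) (⟦⟧-no (a Fin.≟ b) a≢b)) (ℤ.*-zeroʳ (lo a))))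
             (cong (ℤ._*_ (lo b)) (⟦⟧-yes (b Fin.≟ b) refl))) ⟩
    + ℓ ℤ.* 1ℤ ℤ.- lo b ℤ.* 1ℤ                    ≡⟨ cong₂ ℤ._-_ (ℤ.*-identityʳ (+ ℓ)) (ℤ.*-identityʳ (lo b)) ⟩
    + ℓ ℤ.- lo b                                  ∎

  -- These are 1ᵀ A^k 1, 1ᵀ A^k D 1 and tr (D A^k). The factor `1ℤ` gives `total` the weighted shape
  -- of `lucas-∑`.
  total lowTotal lowTrace : ℕ → ℤ
  total    k = ∑[ a < ℓ ] (1ℤ ℤ.* columnSum k a)
  lowTotal k = ∑[ a < ℓ ] (lo a ℤ.* columnSum k a)
  lowTrace k = ∑[ a < ℓ ] (lo a ℤ.* walks ℓ μ k a a)

  total-0 : total 0 ≡ + ℓ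
  total-0 = trans (sum-cong-≗ (λ a → cong (ℤ._*_ 1ℤ) (columnSum-0 a))) (trans (∑-const ℓ 1ℤ) (ℤ.*-identityʳ (+ ℓ)))

  lowTotal-0 : lowTotal 0 ≡ + μ
  lowTotal-0 = trans (sum-cong-≗ (λ a → trans (cong (ℤ._*_ (lo a)) (columnSum-0 a)) (ℤ.*-identityʳ (lo a)))) (∑-low μ≤ℓ)

  total-1 : total 1 ≡ + ℓ ℤ.* + ℓ ℤ.- + μ
  total-1 = begin
    total 1                                   ≡⟨ sum-cong-≗ (λ a → trans (ℤ.*-identityˡ (columnSum 1 a)) (columnSum-1 a)) ⟩
    ∑[ a < ℓ ] (+ ℓ ℤ.- lo a)                 ≡⟨ ∑-minus (λ _ → + ℓ) lo ⟩
    (∑[ a < ℓ ] (+ ℓ)) ℤ.- sum lo               ≡⟨ cong₂ ℤ._-_ (∑-const ℓ (+ ℓ)) (∑-low μ≤ℓ) ⟩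
    + ℓ ℤ.* + ℓ ℤ.- + μ                       ∎

  lowTotal-1 : lowTotal 1 ≡ P ℤ.* + μ
  lowTotal-1 = begin
    lowTotal 1
      ≡⟨ sum-cong-≗ (λ a → begin
           lo a ℤ.* columnSum 1 a               ≡⟨ cong (ℤ._*_ (lo a)) (columnSum-1 a) ⟩
           lo a ℤ.* (+ ℓ ℤ.- lo a)              ≡⟨ lemma₁ (lo a) (+ ℓ) ⟩
           + ℓ ℤ.* lo a ℤ.- lo a ℤ.* lo a       ≡⟨ cong (ℤ._-_ (+ ℓ ℤ.* lo a)) (low-idem μ a) ⟩
           + ℓ ℤ.* lo a ℤ.- lo a                ≡⟨ lemma₂ (lo a) (+ ℓ) ⟩
           P ℤ.* lo a                           ∎) ⟩
    ∑[ a < ℓ ] (P ℤ.* lo a)                     ≡⟨ *-distribˡ-sum P lo ⟨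
    P ℤ.* sum lo                                ≡⟨ cong (ℤ._*_ P) (∑-low μ≤ℓ) ⟩
    P ℤ.* + μ                                   ∎
    where
    lemma₁ : ∀ x l → x ℤ.* (l ℤ.- x) ≡ l ℤ.* x ℤ.- x ℤ.* x
    lemma₁ = solve-∀
    lemma₂ : ∀ x l → l ℤ.* x ℤ.- x ≡ (l ℤ.- 1ℤ) ℤ.* x
    lemma₂ = solve-∀

  -- lowTrace satisfies T (k+1) = lowTotal k − T k; D is a particular solution, and the
  -- homogeneous part is a multiple of (−1)^k.
  private
    D : ℕ → ℤ
    D k = total k ℤ.- V (suc k)

  -- `D k` is what `lowTrace k` would be if tr A^(k+1) were exactly V_(k+1). Both sides obey the
  -- recurrence for `P` and `Q`, so it suffices to compare polynomials in ℓ and μ at k = 0 and k =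
  -- 1.
  lowTotal-formula : ∀ k → lowTotal k ≡ D (suc k) ℤ.+ D k
  lowTotal-formula = lucas-unique {P} {Q}
    (lucas-∑ {ℓ} {P} {Q} lo {columnSum} columnSum-lucas)
    (lucas-combine {P} {Q} {D} D-lucas)
    (trans lowTotal-0 (trans (lemma₀ (+ ℓ) (+ μ)) (cong₂ (λ x y → (x ℤ.- V 2) ℤ.+ (y ℤ.- V 1)) (sym total-1) (sym total-0))))
    (trans lowTotal-1 (trans (lemma₁ (+ ℓ) (+ μ)) (cong₂ ℤ._+_
      -- The recurrence expresses `D 2` by `D 1` and `D 0`, which avoids computing `total 2`.
      (sym (trans (D-lucas 0) (cong₂ (λ x y → P ℤ.* (x ℤ.- V 2) ℤ.- Q ℤ.* (y ℤ.- V 1)) total-1 total-0)))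
      (cong (ℤ._- V 2) (sym total-1)))))
    where
    D-lucas : LucasRecurrence P Q D
    D-lucas = lucas-minus {P} {Q} {total} {V ∘ suc} (lucas-∑ {ℓ} {P} {Q} (λ _ → 1ℤ) {columnSum} columnSum-lucas) (λ k → refl)

    lemma₀ : ∀ l m → m ≡ (l ℤ.* l ℤ.- m ℤ.- ((l ℤ.- 1ℤ) ℤ.* (l ℤ.- 1ℤ) ℤ.- (m ℤ.- l) ℤ.* + 2)) ℤ.+ (l ℤ.- (l ℤ.- 1ℤ))
    lemma₀ = solve-∀

    lemma₁ : ∀ l m → (l ℤ.- 1ℤ) ℤ.* m ≡
      ((l ℤ.- 1ℤ) ℤ.* (l ℤ.* l ℤ.- m ℤ.- ((l ℤ.- 1ℤ) ℤ.* (l ℤ.- 1ℤ) ℤ.- (m ℤ.- l) ℤ.* + 2))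
        ℤ.- (m ℤ.- l) ℤ.* (l ℤ.- (l ℤ.- 1ℤ)))
      ℤ.+ (l ℤ.* l ℤ.- m ℤ.- ((l ℤ.- 1ℤ) ℤ.* (l ℤ.- 1ℤ) ℤ.- (m ℤ.- l) ℤ.* + 2))
    lemma₁ = solve-∀

  -- The constant μ - 1 is the discrepancy at k = 0, where tr D = μ but D 0 = ℓ - (ℓ - 1) = 1. Each
  -- step reverses its sign.
  lowTrace-formula : ∀ k → lowTrace k ≡ D k ℤ.+ (+ μ ℤ.- 1ℤ) ℤ.* (ℤ.-1ℤ ℤ.^ k)
  lowTrace-formula zero = begin
    lowTrace 0
      ≡⟨ sum-cong-≗ (λ a → trans (cong (ℤ._*_ (lo a)) (⟦⟧-yes (a Fin.≟ a) refl)) (ℤ.*-identityʳ (lo a))) ⟩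
    sum lo
      ≡⟨ ∑-low μ≤ℓ ⟩
    + μ
      ≡⟨ lemma (+ ℓ) (+ μ) ⟩
    (+ ℓ ℤ.- P) ℤ.+ (+ μ ℤ.- 1ℤ) ℤ.* 1ℤ
      ≡⟨ cong (λ x → (x ℤ.- P) ℤ.+ (+ μ ℤ.- 1ℤ) ℤ.* 1ℤ) total-0 ⟨
    D 0 ℤ.+ (+ μ ℤ.- 1ℤ) ℤ.* 1ℤ ∎
    where
    lemma : ∀ l m → m ≡ (l ℤ.- (l ℤ.- 1ℤ)) ℤ.+ (m ℤ.- 1ℤ) ℤ.* 1ℤ
    lemma = solve-∀
  lowTrace-formula (suc k) = begin
    lowTrace (suc k)
      ≡⟨ sum-cong-≗ (λ a → trans (low-*-suc k a a) (cong (ℤ._- (lo a ℤ.* walks ℓ μ k a a)) (ℤ.*-comm (columnSum k a) (lo a)))) ⟩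
    ∑[ a < ℓ ] (lo a ℤ.* columnSum k a ℤ.- lo a ℤ.* walks ℓ μ k a a)
      ≡⟨ ∑-minus (λ a → lo a ℤ.* columnSum k a) (λ a → lo a ℤ.* walks ℓ μ k a a) ⟩
    lowTotal k ℤ.- lowTrace k
      ≡⟨ cong₂ ℤ._-_ (lowTotal-formula k) (lowTrace-formula k) ⟩
    (D (suc k) ℤ.+ D k) ℤ.- (D k ℤ.+ (+ μ ℤ.- 1ℤ) ℤ.* (ℤ.-1ℤ ℤ.^ k))
      ≡⟨ lemma (D (suc k)) (D k) (+ μ) (ℤ.-1ℤ ℤ.^ k) ⟩
    D (suc k) ℤ.+ (+ μ ℤ.- 1ℤ) ℤ.* (ℤ.-1ℤ ℤ.^ suc k) ∎
    where
    lemma : ∀ x y m s → (x ℤ.+ y) ℤ.- (y ℤ.+ (m ℤ.- 1ℤ) ℤ.* s) ≡ x ℤ.+ (m ℤ.- 1ℤ) ℤ.* (ℤ.-1ℤ ℤ.* s)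
    lemma = solve-∀

  -- Here tr (J A^k) is the sum `total k` of all entries. The exponent is kept positive: at exponent
  -- 0 the trace is ℓ, while the right side would be μ + 1.
  trace-formula : ∀ k → (∑[ a < ℓ ] walks ℓ μ (suc k) a a) ≡ V (suc k) ℤ.+ (+ μ ℤ.- 1ℤ) ℤ.* (ℤ.-1ℤ ℤ.^ suc k)
  trace-formula k = begin
    ∑[ a < ℓ ] walks ℓ μ (suc k) a a
      ≡⟨ sum-cong-≗ (λ a → trans (walks-suc k a a) (cong (ℤ._- (lo a ℤ.* walks ℓ μ k a a)) (sym (ℤ.*-identityˡ (columnSum k a))))) ⟩
    ∑[ a < ℓ ] (1ℤ ℤ.* columnSum k a ℤ.- lo a ℤ.* walks ℓ μ k a a)
      ≡⟨ ∑-minus (λ a → 1ℤ ℤ.* columnSum k a) (λ a → lo a ℤ.* walks ℓ μ k a a) ⟩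
    total k ℤ.- lowTrace k
      ≡⟨ cong (ℤ._-_ (total k)) (lowTrace-formula k) ⟩
    total k ℤ.- (D k ℤ.+ (+ μ ℤ.- 1ℤ) ℤ.* (ℤ.-1ℤ ℤ.^ k))
      ≡⟨ lemma (total k) (V (suc k)) (+ μ) (ℤ.-1ℤ ℤ.^ k) ⟩
    V (suc k) ℤ.+ (+ μ ℤ.- 1ℤ) ℤ.* (ℤ.-1ℤ ℤ.^ suc k) ∎
    where
    lemma : ∀ t v m s → t ℤ.- (t ℤ.- v ℤ.+ (m ℤ.- 1ℤ) ℤ.* s) ≡ v ℤ.+ (m ℤ.- 1ℤ) ℤ.* (ℤ.-1ℤ ℤ.* s)
    lemma = solve-∀

-- Summation over the rotations.

gcd-% : ∀ m n .{{_ : NonZero n}} → gcd (m % n) n ≡ gcd m n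
gcd-% m n = ∣-antisym
  (gcd-greatest (∣n∣m%n⇒∣m (gcd[m,n]∣n (m % n) n) (gcd[m,n]∣m (m % n) n)) (gcd[m,n]∣n (m % n) n))
  (gcd-greatest (%-presˡ-∣ (gcd[m,n]∣m m n) (gcd[m,n]∣n m n)) (gcd[m,n]∣n m n))

-- Rotations are indexed by 0, ..., n - 1, but `φ` counts within 1, ..., n. As the gcd with n
-- depends only on the residue, rotating the index by one reconciles the two.
∑-gcd-suc : ∀ n .{{_ : NonZero n}} (F : ℕ → ℤ) →
            (∑[ m < n ] F (gcd (toℕ m) n)) ≡ (∑[ m < n ] F (gcd (suc (toℕ m)) n))
∑-gcd-suc n F = trans (∑-permute (λ m → F (gcd (toℕ m) n)) (r n (1 mod n))) (sum-cong-≗ λ m → cong F (begin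
  gcd (toℕ (rotate n (toℕ (1 mod n)) m)) n  ≡⟨ cong (λ v → gcd (toℕ v) n) (rotate-mod n 1 m) ⟩
  gcd (toℕ (rotate n 1 m)) n                ≡⟨ cong (λ x → gcd x n) (toℕ-rotate n 1 m) ⟩
  gcd ((toℕ m ℕ.+ 1) % n) n                 ≡⟨ gcd-% (toℕ m ℕ.+ 1) n ⟩
  gcd (toℕ m ℕ.+ 1) n                       ≡⟨ cong (λ x → gcd x n) (ℕ.+-comm (toℕ m) 1) ⟩
  gcd (suc (toℕ m)) n                       ∎))

sign : ℕ → ℤ
sign k = ℤ.-1ℤ ℤ.^ k

sign-2+ : ∀ k → sign (2 ℕ.+ k) ≡ sign k
sign-2+ k = lemma (sign k)
  where
  lemma : ∀ x → ℤ.-1ℤ ℤ.* (ℤ.-1ℤ ℤ.* x) ≡ x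
  lemma = solve-∀

sign-even : ∀ {k} → 2 ∣ k → sign k ≡ 1ℤ
sign-even {zero}        _   = refl
sign-even {suc zero}    2∣1 = contradiction (∣⇒≤ 2∣1) λ { (s≤s ()) }
sign-even {suc (suc k)} 2∣k = trans (sign-2+ k) (sign-even (∣m+n∣m⇒∣n 2∣k ∣-refl))

sign-odd : ∀ {k} → 2 ∤ k → sign k ≡ ℤ.-1ℤ
sign-odd {zero}        2∤0 = contradiction (divides 0 refl) 2∤0
sign-odd {suc zero}    _   = refl
sign-odd {suc (suc k)} 2∤k = trans (sign-2+ k) (sign-odd (2∤k ∘ ∣m∣n⇒∣m+n ∣-refl))

sign-cong : ∀ {j k} → (2 ∣ j ⇔ 2 ∣ k) → sign j ≡ sign k
sign-cong {j} {k} j⇔k with 2 ∣? k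
... | yes 2∣k = trans (sign-even (Equivalence.from j⇔k 2∣k)) (sym (sign-even 2∣k))
... | no  2∤k = trans (sign-odd (2∤k ∘ Equivalence.to j⇔k)) (sym (sign-odd 2∤k))

∑-sign-gcd-odd : ∀ {n} → 2 ∤ n → (∑[ m < n ] sign (gcd (suc (toℕ m)) n)) ≡ ℤ.- + n
∑-sign-gcd-odd {n} 2∤n = begin
  ∑[ m < n ] sign (gcd (suc (toℕ m)) n)
    ≡⟨ sum-cong-≗ {n} (λ m → sign-odd λ 2∣gcd → 2∤n (∣-trans 2∣gcd (gcd[m,n]∣n (suc (toℕ m)) n))) ⟩
  ∑[ m < n ] ℤ.-1ℤ  ≡⟨ ∑-const n ℤ.-1ℤ ⟩
  + n ℤ.* ℤ.-1ℤ     ≡⟨ ℤ.*-comm (+ n) ℤ.-1ℤ ⟩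
  ℤ.-1ℤ ℤ.* + n     ≡⟨ ℤ.-1*i≡-i (+ n) ⟩
  ℤ.- + n           ∎

∑-sign : ∀ q → (∑[ m < q ℕ.* 2 ] sign (suc (toℕ m))) ≡ 0ℤ
∑-sign zero    = refl
∑-sign (suc q) = begin
  sign 1 ℤ.+ (sign 2 ℤ.+ (∑[ m < q ℕ.* 2 ] sign (3 ℕ.+ toℕ m)))
    ≡⟨ cong (λ x → sign 1 ℤ.+ (sign 2 ℤ.+ x)) (trans (sum-cong-≗ {q ℕ.* 2} (λ m → sign-2+ (suc (toℕ m)))) (∑-sign q)) ⟩
  0ℤ ∎

-- For even n the gcd of m and n has the parity of m, so the signs alternate and cancel in pairs.
∑-sign-gcd-even : ∀ {n} → 2 ∣ n → (∑[ m < n ] sign (gcd (suc (toℕ m)) n)) ≡ 0ℤ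
∑-sign-gcd-even {n} 2∣n@(divides q refl) = trans
  (sum-cong-≗ {n} λ m → sign-cong (mk⇔
    (λ 2∣gcd → ∣-trans 2∣gcd (gcd[m,n]∣m (suc (toℕ m)) n))
    (λ 2∣m → gcd-greatest 2∣m 2∣n)))
  (∑-sign q)

proper-formula : ∀ d {ℓ μ} .{{_ : NonZero d}} → μ ≤ ℓ →
  (∑[ x < ℓ ℕ.^ d ] ⟦ proper? d ℓ μ (finToFun x) ⟧)
  ≡ lucasV (+ ℓ ℤ.- + 1) (+ μ ℤ.- + ℓ) d ℤ.+ (+ μ ℤ.- 1ℤ) ℤ.* sign d
proper-formula (suc k) {ℓ} {μ} μ≤ℓ = trans (proper-count ℓ μ k) (trace-formula μ≤ℓ k)

module _ (n ℓ μ : ℕ) .{{_ : NonZero n}} (μ≤ℓ : μ ≤ ℓ) where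

  private
    V : ℕ → ℤ
    V = lucasV (+ ℓ ℤ.- + 1) (+ μ ℤ.- + ℓ)

  n*OP : + n ℤ.* + OP (cycle n) (Rot n) ℓ μ
         ≡ ∑-divisors n (λ d → + φ (n ℕ./ d) ℤ.* V d)
           ℤ.+ (+ μ ℤ.- 1ℤ) ℤ.* (∑[ m < n ] sign (gcd (suc (toℕ m)) n))
  n*OP = begin
    + n ℤ.* + OP (cycle n) (Rot n) ℓ μ
      ≡⟨ burnside n ℓ μ ⟨
    ∑[ m < n ] ∑[ x < ℓ ℕ.^ n ] ⟦ fixed? n ℓ μ (toℕ m) (finToFun x) ⟧
      ≡⟨ sum-cong-≗ {n} (λ m → fixed-formula (toℕ m)) ⟩
    ∑[ m < n ] T (gcd (toℕ m) n)
      ≡⟨ ∑-gcd-suc n T ⟩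
    ∑[ m < n ] T (gcd (suc (toℕ m)) n)
      ≡⟨ ∑-distrib-+ {n} (λ m → V (gcd (suc (toℕ m)) n)) (λ m → (+ μ ℤ.- 1ℤ) ℤ.* sign (gcd (suc (toℕ m)) n)) ⟩
    (∑[ m < n ] V (gcd (suc (toℕ m)) n)) ℤ.+ (∑[ m < n ] ((+ μ ℤ.- 1ℤ) ℤ.* sign (gcd (suc (toℕ m)) n)))
      ≡⟨ cong₂ ℤ._+_ (∑-gcd n V) (sym (*-distribˡ-sum {n} (+ μ ℤ.- 1ℤ) (λ m → sign (gcd (suc (toℕ m)) n)))) ⟩
    ∑-divisors n (λ d → + φ (n ℕ./ d) ℤ.* V d)
      ℤ.+ (+ μ ℤ.- 1ℤ) ℤ.* (∑[ m < n ] sign (gcd (suc (toℕ m)) n)) ∎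
    where
    T : ℕ → ℤ
    T d = V d ℤ.+ (+ μ ℤ.- 1ℤ) ℤ.* sign d

    fixed-formula : ∀ m → (∑[ x < ℓ ℕ.^ n ] ⟦ fixed? n ℓ μ m (finToFun x) ⟧) ≡ T (gcd m n)
    fixed-formula m = trans (fixed-count n (gcd m n) m ℓ μ (gcd-GCD m n)) (proper-formula (gcd m n) μ≤ℓ)
      where
      instance
        gcd≢0 : NonZero (gcd m n)
        gcd≢0 = ℕ.≢-nonZero (gcd[m,n]≢0 m n (inj₂ (ℕ.≢-nonZero⁻¹ n)))

-- Passage to the rationals.

toℚᵘ-/ : ∀ i n → toℚᵘ (i / suc n) ℚᵘ.≃ mkℚᵘ i n
toℚᵘ-/ i n = ℚ.toℚᵘ-fromℚᵘ (mkℚᵘ i n)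

/1-homo-+ : ∀ i j → (i ℤ.+ j) / 1 ≡ i / 1 + j / 1
/1-homo-+ i j = ℚ.toℚᵘ-injective (ℚᵘ.≃-trans (toℚᵘ-/ (i ℤ.+ j) 0) (ℚᵘ.≃-sym (ℚᵘ.≃-trans
  (ℚᵘ.≃-trans (ℚ.toℚᵘ-homo-+ (i / 1) (j / 1)) (ℚᵘ.+-cong (toℚᵘ-/ i 0) (toℚᵘ-/ j 0)))
  (*≡* (lemma i j)))))
  where
  lemma : ∀ i j → (i ℤ.* 1ℤ ℤ.+ j ℤ.* 1ℤ) ℤ.* 1ℤ ≡ (i ℤ.+ j) ℤ.* 1ℤ
  lemma = solve-∀

/1-homo-neg : ∀ i → (ℤ.- i) / 1 ≡ - (i / 1)
/1-homo-neg i = ℚ.toℚᵘ-injective (ℚᵘ.≃-trans (toℚᵘ-/ (ℤ.- i) 0) (ℚᵘ.≃-sym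
  (ℚᵘ.≃-trans (ℚ.toℚᵘ-homo‿- (i / 1)) (ℚᵘ.-‿cong (toℚᵘ-/ i 0)))))

-- Checked in the unnormalised rationals, where no reduction to lowest terms intervenes and equality
-- is cross-multiplication.
/1-divide : ∀ n .{{_ : NonZero n}} {i j} → + n ℤ.* i ≡ j → i / 1 ≡ (+ 1 / n) * (j / 1)
/1-divide (suc n) {i} {j} eq = ℚ.toℚᵘ-injective (ℚᵘ.≃-trans (toℚᵘ-/ i 0) (ℚᵘ.≃-sym (ℚᵘ.≃-trans
  (ℚᵘ.≃-trans (ℚ.toℚᵘ-homo-* (+ 1 / suc n) (j / 1)) (ℚᵘ.*-cong (toℚᵘ-/ (+ 1) n) (toℚᵘ-/ j 0)))
  (*≡* (trans (trans (lemma j) (sym eq)) (trans (ℤ.*-comm (+ suc n) i)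
    (cong (λ x → i ℤ.* + x) (sym (ℕ.*-identityʳ (suc n))))))))))
  where
  lemma : ∀ j → 1ℤ ℤ.* j ℤ.* 1ℤ ≡ j
  lemma = solve-∀

theorem10 : (n ℓ μ : ℕ) .{{_ : NonZero n}} .{{_ : NonZero ℓ}} → μ ≤ ℓ →
    (2 ∤ n → + OP (cycle n) (Rot n) ℓ μ / 1
    ≡ (+ 1 / n) * (∑-divisors n (λ d → + φ (n ℕ./ d) ℤ.* lucasV (+ ℓ ℤ.- + 1) (+ μ ℤ.- + ℓ) d) / 1)
    - (+ μ / 1) + 1ℚ)
    × (2 ∣ n → + OP (cycle n) (Rot n) ℓ μ / 1
    ≡ (+ 1 / n) * (∑-divisors n (λ d → + φ (n ℕ./ d) ℤ.* lucasV (+ ℓ ℤ.- + 1) (+ μ ℤ.- + ℓ) d) / 1))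
theorem10 n ℓ μ μ≤ℓ = odd , even
  where
  X N : ℤ
  X = ∑-divisors n (λ d → + φ (n ℕ./ d) ℤ.* lucasV (+ ℓ ℤ.- + 1) (+ μ ℤ.- + ℓ) d)
  N = + OP (cycle n) (Rot n) ℓ μ

  odd : 2 ∤ n → N / 1 ≡ (+ 1 / n) * (X / 1) - (+ μ / 1) + 1ℚ
  odd 2∤n = begin
    N / 1                                       ≡⟨ cong (_/ 1) (lemma₁ N (+ μ)) ⟩
    (M ℤ.- + μ ℤ.+ 1ℤ) / 1                      ≡⟨ /1-homo-+ (M ℤ.- + μ) 1ℤ ⟩
    (M ℤ.- + μ) / 1 + 1ℚ                        ≡⟨ cong (_+ 1ℚ) (/1-homo-+ M (ℤ.- + μ)) ⟩
    M / 1 + (ℤ.- + μ) / 1 + 1ℚ                  ≡⟨ cong (λ x → M / 1 + x + 1ℚ) (/1-homo-neg (+ μ)) ⟩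
    M / 1 - (+ μ / 1) + 1ℚ                      ≡⟨ cong (λ x → x - (+ μ / 1) + 1ℚ) (/1-divide n nM) ⟩
    (+ 1 / n) * (X / 1) - (+ μ / 1) + 1ℚ        ∎
    where
    -- For odd n the sign sum is -n, so nN = X - (μ - 1)n and N + μ - 1 is the integer X/n.
    M : ℤ
    M = N ℤ.+ + μ ℤ.- 1ℤ

    lemma₁ : ∀ a m → a ≡ a ℤ.+ m ℤ.- 1ℤ ℤ.- m ℤ.+ 1ℤ
    lemma₁ = solve-∀

    lemma₂ : ∀ n a m → n ℤ.* (a ℤ.+ m ℤ.- 1ℤ) ≡ n ℤ.* a ℤ.+ (m ℤ.- 1ℤ) ℤ.* n
    lemma₂ = solve-∀

    lemma₃ : ∀ x m n → x ℤ.+ (m ℤ.- 1ℤ) ℤ.* (ℤ.- n) ℤ.+ (m ℤ.- 1ℤ) ℤ.* n ≡ x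
    lemma₃ = solve-∀

    nM : + n ℤ.* M ≡ X
    nM = begin
      + n ℤ.* M
        ≡⟨ lemma₂ (+ n) N (+ μ) ⟩
      + n ℤ.* N ℤ.+ (+ μ ℤ.- 1ℤ) ℤ.* + n
        ≡⟨ cong (ℤ._+ (+ μ ℤ.- 1ℤ) ℤ.* + n) (trans (n*OP n ℓ μ μ≤ℓ)
             (cong (λ x → X ℤ.+ (+ μ ℤ.- 1ℤ) ℤ.* x) (∑-sign-gcd-odd 2∤n))) ⟩
      X ℤ.+ (+ μ ℤ.- 1ℤ) ℤ.* (ℤ.- + n) ℤ.+ (+ μ ℤ.- 1ℤ) ℤ.* + n
        ≡⟨ lemma₃ X (+ μ) (+ n) ⟩
      X ∎

  even : 2 ∣ n → N / 1 ≡ (+ 1 / n) * (X / 1)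
  even 2∣n = /1-divide n (begin
    + n ℤ.* N
      ≡⟨ n*OP n ℓ μ μ≤ℓ ⟩
    X ℤ.+ (+ μ ℤ.- 1ℤ) ℤ.* (∑[ m < n ] sign (gcd (suc (toℕ m)) n))
      ≡⟨ cong (λ x → X ℤ.+ (+ μ ℤ.- 1ℤ) ℤ.* x) (∑-sign-gcd-even 2∣n) ⟩
    X ℤ.+ (+ μ ℤ.- 1ℤ) ℤ.* 0ℤ
      ≡⟨ cong (ℤ._+_ X) (ℤ.*-zeroʳ (+ μ ℤ.- 1ℤ)) ⟩
    X ℤ.+ 0ℤ
      ≡⟨ ℤ.+-identityʳ X ⟩
    X ∎)
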